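{- Let $q=3^r>3$, and let $$\bar f_2(x_1,x_2)=t\bigl(x_1^{q-4}+x_2^{q-2}\bigr).$$ Then the polynomial $t\bigl(\bar f_2(x_1,x_2)+x_3^{q-2}\bigr)\in\mathbb{F}_q[x_1,x_2,x_3]$, reduced modulo $x_j^q-x_j$, has degree $3(q-2)$.
   Context: $\mathbb{F}_q$ is the finite field with $q$ elements, and $$t(x)=x+\sum_{k=0}^{q-2}x^k\in\mathbb{F}_q[x];$$ this polynomial swaps $0$ and $1$ and fixes every other element. Degree means the total degree of the reduced representative (degree $<q$ in each variable). -}

module Defs where

open import Algebra.Apartness.Bundles using (HeytingField; HeytingCommutativeRing)
open import Algebra.Bundles using (CommutativeRing)
open import Algebra.Bundles.Raw using (RawRing)
import Algebra.Definitions.RawSemiring as RawSemiringDefinitions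
open import Data.Bool.Base using (if_then_else_)
open import Data.Fin.Base using (Fin; toℕ)
open import Data.List.Base using (List; []; _∷_; _++_; map; cartesianProductWith)
open import Data.Nat.Base as ℕ using (ℕ; _∸_; _≤_; _<_)
import Data.Nat.Properties as ℕ
open import Data.Product.Base using (_×_; _,_; ∃-syntax; Σ-syntax)
open import Data.Vec.Base using (Vec; replicate; zipWith; sum; _[_]≔_)
open import Data.Vec.Properties using (≡-dec)
open import Data.Vec.Relation.Unary.All using (All)
open import Function.Bundles using (Inverse)
open import Level using (_⊔_)
open import Relation.Binary.PropositionalEquality using (_≡_; setoid)
open import Relation.Nullary.Decidable.Core using (does)
open import Relation.Nullary.Negation using (¬_)

module _ {c ℓ₁ ℓ₂} (F : HeytingField c ℓ₁ ℓ₂) where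

  fieldRing : CommutativeRing c ℓ₁
  fieldRing = HeytingCommutativeRing.commutativeRing (HeytingField.heytingCommutativeRing F)

  -- For a field with finitely many elements, equality is decidable and the
  -- tight apartness coincides with inequality, so a Heyting field of this kind
  -- is the same thing as a finite field in the classical sense.
  HasCardinality : ℕ → Set (c ⊔ ℓ₁)
  HasCardinality q = Inverse (CommutativeRing.setoid fieldRing) (setoid (Fin q))

module Polynomials {c ℓ} (R : RawRing c ℓ) where

  private
    module R = RawRing R

  Exponent : ℕ → Set
  Exponent n = Vec ℕ n

  -- A polynomial in n variables is a formal finite sum of terms; exponents may
  -- be repeated and coefficients may vanish.  Only _≈ₚ_ is meaningful equality.
  Poly : ℕ → Set c
  Poly n = List (R.Carrier × Exponent n)

  module _ {n : ℕ} where

    coeff : Poly n → Exponent n → R.Carrier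
    coeff []            e = R.0#
    coeff ((a , d) ∷ p) e = (if does (≡-dec ℕ._≟_ d e) then a else R.0#) R.+ coeff p e

    infix 4 _≈ₚ_
    _≈ₚ_ : Poly n → Poly n → Set ℓ
    p ≈ₚ p′ = ∀ e → coeff p e R.≈ coeff p′ e

    mulTerm : R.Carrier × Exponent n → R.Carrier × Exponent n → R.Carrier × Exponent n
    mulTerm (a , d) (b , e) = a R.* b , zipWith ℕ._+_ d e

    X : Fin n → Poly n
    X j = (R.1# , replicate n 0 [ j ]≔ 1) ∷ []

  polyRawRing : ℕ → RawRing c ℓ
  polyRawRing n = record
    { Carrier = Poly n
    ; _≈_     = _≈ₚ_
    ; _+_     = _++_
    ; _*_     = cartesianProductWith mulTerm
    ; -_      = map (λ (a , e) → R.- a , e)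
    ; 0#      = []
    ; 1#      = (R.1# , replicate n 0) ∷ []
    }

  module _ {n : ℕ} where

    open RawRing (polyRawRing n) using (_+_; _*_; -_)
    open RawSemiringDefinitions (RawRing.rawSemiring (polyRawRing n)) using (_^_) renaming (sum to sumₚ)

    -- t(p) = p + Σ_{k=0}^{q-2} p^k, i.e. the polynomial p substituted into t.
    t : ℕ → Poly n → Poly n
    t q p = p + sumₚ {q ∸ 1} (λ k → p ^ toℕ k)

    f̄₂ : ℕ → Poly n → Poly n → Poly n
    f̄₂ q x₁ x₂ = t q (x₁ ^ (q ∸ 4) + x₂ ^ (q ∸ 2))

    f̄₃ : ℕ → Poly n → Poly n → Poly n → Poly n
    f̄₃ q x₁ x₂ x₃ = t q (f̄₂ q x₁ x₂ + x₃ ^ (q ∸ 2))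

    -- Congruence modulo the ideal generated by the x_j^q - x_j.
    CongruentModulo : ℕ → Poly n → Poly n → Set (c ⊔ ℓ)
    CongruentModulo q p p′ =
      Σ[ h ∈ (Fin n → Poly n) ] p ≈ₚ p′ + sumₚ {n} (λ j → h j * (X j ^ q + (- X j)))

    IsReduced : ℕ → Poly n → Set ℓ
    IsReduced q p = ∀ e → ¬ coeff p e R.≈ R.0# → All (_< q) e

    IsReducedRepresentative : ℕ → Poly n → Poly n → Set (c ⊔ ℓ)
    IsReducedRepresentative q p g = IsReduced q g × CongruentModulo q p g

    HasTotalDegree : Poly n → ℕ → Set ℓ
    HasTotalDegree p d =
      (∃[ e ] ¬ coeff p e R.≈ R.0# × sum e ≡ d) ×
      (∀ e → ¬ coeff p e R.≈ R.0# → sum e ≤ d)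

    -- The reduced representative is unique only up to _≈ₚ_, so "the reduced
    -- representative has degree d" says that one exists and all have degree d.
    HasReducedDegree : ℕ → Poly n → ℕ → Set (c ⊔ ℓ)
    HasReducedDegree q p d =
      (∃[ g ] IsReducedRepresentative q p g) ×
      (∀ g → IsReducedRepresentative q p g → HasTotalDegree g d)

{-# OPTIONS --safe #-}

-- Write 1/x for x^(q−2) (so 1/0 = 0); then x^(q−4) = 1/x³, and t is the transposition of 0 and 1.
-- As Σ_x x^m is −1 for m = q−1 and 0 for the other m < 2(q−1), the coefficient at x₁^a₁ x₂^a₂ x₃^a₃
-- (all aᵢ > 0) of the reduced form of a function F on 𝔽_q³ is −Σ F x₁^b₁ x₂^b₂ x₃^b₃ with bᵢ = q−1−aᵢ.
--
-- Here F = t(t(1/x₁³ + 1/x₂) + 1/x₃) is a permutation in each variable separately, so the sum over xᵢ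
-- vanishes when bᵢ = 0.  Hence aᵢ ≤ q−2 in such a monomial, and a monomial in which some variable is
-- missing has degree at most 2(q−1) ≤ 3(q−2).
--
-- For b = (1,1,1), replace xᵢ by 1/xᵢ.  Since t(y) = y + [y = 0] − [y = 1], and since
-- 1/(−s) − 1/(1−s) does not change when s is replaced by t(s), the sum over x₃ leaves
-- 1/(s−1) − 1/s − 1 with s = x₁³ + x₂.  From Σ_x 1/(x(u+x)) = −1/u² in characteristic 3, the sum over x₂
-- leaves 1/x₁⁶ − 1/(x₁−1)⁶, and Σ 1/x⁷ = 0 while Σ 1/(x(x−1)⁶) = −1.  So the coefficient is ±1.
module Submission where

open import Defs
open import Algebra.Apartness.Bundles using (HeytingField)
open import Algebra.Bundles using (CommutativeMonoid; CommutativeRing)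
open import Algebra.Bundles.Raw using (RawRing)
import Algebra.Definitions.RawSemiring as RawSemiringDefinitions
import Algebra.Solver.Ring as RingSolver
open import Algebra.Solver.Ring.AlmostCommutativeRing using (_-Raw-AlmostCommutative⟶_; fromCommutativeRing)
open import Data.Bool.Base using (if_then_else_; true; false)
open import Data.Fin.Base as Fin using (Fin; zero; suc; toℕ)
open import Data.Fin.Patterns using (0F; 1F; 2F)
import Data.Fin.Properties as Fin
open import Data.List.Base as List using (List; []; _∷_; _++_; deduplicate)
open import Data.List.Membership.Propositional using (_∈_)
open import Data.List.Membership.Propositional.Properties using (∈-++⁺ˡ; ∈-++⁺ʳ; ∈-deduplicate⁺)
open import Data.List.Properties using (cartesianProductWith-distribʳ-++)
import Data.List.Relation.Unary.All as ListAll
open import Data.List.Relation.Unary.AllPairs using ([]; _∷_)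
open import Data.List.Relation.Unary.Any using (here; there)
open import Data.List.Relation.Unary.Unique.DecPropositional.Properties using (deduplicate-!)
open import Data.List.Relation.Unary.Unique.Propositional using (Unique)
open import Data.Maybe.Base as Maybe using (Maybe)
open import Data.Nat.Base as ℕ using (ℕ; zero; suc; _∸_; _≤_; _<_; s≤s; z≤n)
open import Data.Nat.DivMod using (_%_; _/_; m≡m%n+[m/n]*n)
open import Data.Nat.Induction using (<-wellFounded)
import Data.Nat.Properties as ℕ
open import Data.Nat.Solver using () renaming (module +-*-Solver to ℕ-Solver)
open import Data.Product.Base using (_×_; _,_; ∃-syntax; proj₁; proj₂)
open import Data.Sum.Base using (_⊎_; inj₁; inj₂)
open import Data.Vec.Base as Vec using (Vec; []; _∷_; replicate; zipWith; lookup; _[_]≔_)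
open import Data.Vec.Properties using (≡-dec; zipWith-identityʳ)
open import Data.Vec.Relation.Unary.All using (All; []; _∷_)
open import Function.Base using (_∘_)
open import Function.Bundles using (Inverse)
import Function.Construct.Composition as Composition
import Function.Construct.Symmetry as Symmetry
open import Function.Definitions using (Congruent)
open import Function.Properties.Inverse using (Inverse⇒Injection)
open import Induction.WellFounded using (Acc; acc)
open import Level using (_⊔_)
open import Relation.Binary.Bundles using (Setoid)
open import Relation.Binary.Consequences using (dec⇒weaklyDec)
open import Relation.Binary.Definitions using (Decidable; tri<; tri≈; tri>)
open import Relation.Binary.PropositionalEquality as ≡ using (_≡_; _≢_)
open import Relation.Nullary using (¬_; yes; no; does; contradiction)
open import Relation.Nullary.Decidable using (True; toWitness; ¬?; _×-dec_; decidable-stable; via-injection)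

-- Polynomials are lists of terms, equal when their coefficients agree. Evaluation, extraction of a
-- coefficient and moments are all linear functionals given by a weight on exponents, and such a
-- functional depends on coefficients only. So two functionals that agree on reduced monomials agree
-- on every reduced form.
--
-- The restriction to positive exponents is forced: for `a = 0` the weight is `b = q - 1`, and the
-- exponents 0 and `q - 1` would both give the power sum -1. Monomials that lack a variable are
-- therefore bounded by counting alone.
--
-- The degree claim also asks for a reduced representative to exist; it arises by replacing `x_j^q`
-- by `x_j` term by term.
--
-- Since 1/0 is 0, every identity between fractions has to hold at its poles too, which accounts for
-- the case distinctions and for the particular forms of the identities. A power of 3 above 3 is at
-- least 9; writing `q = 9 + k` lets `q - 2` and `q - 4` compute, and puts the largest power-sum
-- exponent that occurs with value 0, namely 7, below `q - 1`.

-- Exponent vectors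

unit : ∀ {n} → Fin n → ℕ → Vec ℕ n
unit {n} j k = replicate n 0 [ j ]≔ k

zipWith-replicate-0 : ∀ {n} (u : Vec ℕ n) → zipWith ℕ._+_ u (replicate n 0) ≡ u
zipWith-replicate-0 = zipWith-identityʳ ℕ.+-identityʳ

unit-+ : ∀ {n} (j : Fin n) k l → zipWith ℕ._+_ (unit j k) (unit j l) ≡ unit j (k ℕ.+ l)
unit-+ {suc n} zero    k l = ≡.cong (_ ∷_) (zipWith-replicate-0 (replicate n 0))
unit-+ {suc n} (suc j) k l = ≡.cong (0 ∷_) (unit-+ j k l)

unit-0 : ∀ {n} (j : Fin n) → unit j 0 ≡ replicate n 0
unit-0 zero    = ≡.refl
unit-0 (suc j) = ≡.cong (0 ∷_) (unit-0 j)

sum-+-unit : ∀ {n} (u : Vec ℕ n) j k → Vec.sum (zipWith ℕ._+_ u (unit j k)) ≡ Vec.sum u ℕ.+ k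
sum-+-unit (x ∷ u) zero    k =
  ≡.trans (≡.cong (λ v → x ℕ.+ k ℕ.+ Vec.sum v) (zipWith-replicate-0 u)) (xy∙z≈xz∙y x k (Vec.sum u))
  where open import Algebra.Properties.CommutativeSemigroup ℕ.+-commutativeSemigroup using (xy∙z≈xz∙y)
sum-+-unit (x ∷ u) (suc j) k =
  ≡.trans (≡.cong₂ ℕ._+_ (ℕ.+-identityʳ x) (sum-+-unit u j k)) (≡.sym (ℕ.+-assoc x _ k))

reduced-or-divisible : ∀ {n} q (d : Vec ℕ n) →
  All (_< q) d ⊎ (∃[ u ] ∃[ j ] d ≡ zipWith ℕ._+_ u (unit j q))
reduced-or-divisible q []       = inj₁ []
reduced-or-divisible q (x ∷ d) with x ℕ.<? q | reduced-or-divisible q d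
... | yes x<q | inj₁ d<q            = inj₁ (x<q ∷ d<q)
... | yes x<q | inj₂ (u , j , eq)   = inj₂ (x ∷ u , suc j , ≡.cong₂ _∷_ (≡.sym (ℕ.+-identityʳ x)) eq)
... | no  x≮q | _                   =
  inj₂ (x ∸ q ∷ d , zero , ≡.cong₂ _∷_ (≡.sym (ℕ.m∸n+n≡m (ℕ.≮⇒≥ x≮q))) (≡.sym (zipWith-replicate-0 d)))

infixl 5 _⨾_
_⨾_ : ∀ {a₁ a₂ b₁ b₂ c₁ c₂} {A : Setoid a₁ a₂} {B : Setoid b₁ b₂} {C : Setoid c₁ c₂} →
      Inverse A B → Inverse B C → Inverse A C
_⨾_ = Composition.inverse

-- Sums over a finite carrier

module FiniteSums {c ℓ} (M : CommutativeMonoid c ℓ) where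

  open CommutativeMonoid M
  open import Algebra.Properties.CommutativeMonoid.Sum M
    using (sum; sum-cong-≋; sum-replicate-zero; ∑-distrib-+; sum-permute)

  sum-ε : ∀ {k} (f : Fin k → Carrier) → (∀ i → f i ≈ ε) → sum f ≈ ε
  sum-ε {k} f f≈ε = trans (sum-cong-≋ {n = k} f≈ε) (sum-replicate-zero k)

  sum-single : ∀ {k} (f : Fin k → Carrier) i → (∀ j → j ≢ i → f j ≈ ε) → sum f ≈ f i
  sum-single {suc k} f zero    f≈ε =
    trans (∙-congˡ (sum-ε (f ∘ suc) λ j → f≈ε (suc j) λ ())) (identityʳ _)
  sum-single {suc k} f (suc i) f≈ε =
    trans (∙-cong (f≈ε zero λ ())
                  (sum-single (f ∘ suc) i λ j j≢i → f≈ε (suc j) (j≢i ∘ Fin.suc-injective)))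
          (identityˡ _)

  module OverCarrier {N : ℕ} (enumeration : Inverse setoid (≡.setoid (Fin N))) where

    open Inverse enumeration

    opaque
      -- The sum takes one representative `from i` of each class. It is sealed because over an index
      -- set such as `Fin (9 + k)` an open sum would split off nine terms by computation.
      ∑ : (Carrier → Carrier) → Carrier
      ∑ f = sum λ i → f (from i)

      ∑≈sum : ∀ f → ∑ f ≈ sum (λ i → f (from i))
      ∑≈sum f = refl

      ∑-cong : ∀ {f g} → (∀ x → f x ≈ g x) → ∑ f ≈ ∑ g
      ∑-cong eq = sum-cong-≋ {n = N} λ i → eq (from i)

      ∑-∙ : ∀ f g → ∑ (λ x → f x ∙ g x) ≈ ∑ f ∙ ∑ g
      ∑-∙ f g = ∑-distrib-+ (λ i → f (from i)) (λ i → g (from i))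

      -- Conjugation by the enumeration turns `π` into a permutation of `Fin N`. The chosen
      -- representative of `π x` is only equivalent to `π x`, hence the congruence of `f`.
      ∑-permute : ∀ {f} (π : Inverse setoid setoid) → Congruent _≈_ _≈_ f → ∑ (λ x → f (Inverse.to π x)) ≈ ∑ f
      ∑-permute {f} π f-cong = sym (trans
        (sum-permute (λ i → f (from i)) (Symmetry.inverse enumeration ⨾ π ⨾ enumeration))
        (sum-cong-≋ {n = N} λ i → f-cong (strictlyInverseʳ (Inverse.to π (from i)))))

      ∑-single : ∀ {f} → Congruent _≈_ _≈_ f → ∀ a → (∀ x → ¬ x ≈ a → f x ≈ ε) → ∑ f ≈ f a
      ∑-single f-cong a f≈ε = trans
        (sum-single _ (to a) λ j j≢ → f≈ε (from j) λ fj≈a → j≢ (≡.trans (≡.sym (strictlyInverseˡ j)) (to-cong fj≈a)))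
        (f-cong (strictlyInverseʳ a))

-- Formal sums of terms and linear functionals on them

module FormalSums {c ℓ} (R : CommutativeRing c ℓ) where

  open CommutativeRing R hiding (zero)
  open Polynomials rawRing
  open import Algebra.Properties.Ring ring using (-‿distribˡ-*; -‿+-comm; -0#≈0#)
  open import Algebra.Properties.CommutativeSemiring.Exp commutativeSemiring
  open import Algebra.Properties.CommutativeMonoid.Sum +-commutativeMonoid using (sum; sum-cong-≋; ∑-distrib-+)
  open FiniteSums +-commutativeMonoid using (sum-single) renaming (sum-ε to sum-zero)
  open import Algebra.Properties.CommutativeSemigroup +-commutativeSemigroup using (interchange)
  open import Algebra.Properties.CommutativeSemigroup *-commutativeSemigroup using () renaming (interchange to *-interchange)
  open import Relation.Binary.Reasoning.Setoid setoid

  infix 4 _≟ᵉ_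
  _≟ᵉ_ : ∀ {n} (d e : Exponent n) → _
  _≟ᵉ_ = ≡-dec ℕ._≟_

  module _ {n : ℕ} where

    open RawSemiringDefinitions (RawRing.rawSemiring (polyRawRing n)) using () renaming (sum to sumₚ)

    -- The linear functional with value `m d` on the monomial of exponent `d`. The weight
    -- `monomial xs` gives evaluation at a point, `indicator` gives a coefficient.
    evalWith : (Exponent n → Carrier) → Poly n → Carrier
    evalWith m []            = 0#
    evalWith m ((a , d) ∷ p) = a * m d + evalWith m p

    evalWith-++ : ∀ m p r → evalWith m (p ++ r) ≈ evalWith m p + evalWith m r
    evalWith-++ m []            r = sym (+-identityˡ _)
    evalWith-++ m ((a , d) ∷ p) r = trans (+-congˡ (evalWith-++ m p r)) (sym (+-assoc _ _ _))

    evalWith-sum : ∀ m {k} (f : Fin k → Poly n) → evalWith m (sumₚ f) ≈ sum (λ i → evalWith m (f i))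
    evalWith-sum m {zero}  f = refl
    evalWith-sum m {suc k} f = trans (evalWith-++ m (f zero) _) (+-congˡ (evalWith-sum m (f ∘ suc)))

    indicator : Exponent n → Carrier → Exponent n → Carrier
    indicator e κ d = if does (d ≟ᵉ e) then κ else 0#

    indicator-refl : ∀ e κ → indicator e κ e ≈ κ
    indicator-refl e κ with e ≟ᵉ e
    ... | yes _  = refl
    ... | no e≢e = contradiction ≡.refl e≢e

    indicator-≢ : ∀ {e d} κ → d ≢ e → indicator e κ d ≈ 0#
    indicator-≢ {e} {d} κ d≢e with d ≟ᵉ e
    ... | yes d≡e = contradiction d≡e d≢e
    ... | no _    = refl

    evalWith-indicator : ∀ e κ p → evalWith (indicator e κ) p ≈ coeff p e * κ
    evalWith-indicator e κ []            = sym (zeroˡ κ)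
    evalWith-indicator e κ ((a , d) ∷ p) with d ≟ᵉ e
    ... | yes _ = trans (+-congˡ (evalWith-indicator e κ p)) (sym (distribʳ κ a _))
    ... | no  _ = trans (+-cong (trans (zeroʳ a) (sym (zeroˡ κ))) (evalWith-indicator e κ p)) (sym (distribʳ κ 0# _))

    coeff-++ : ∀ (p r : Poly n) e → coeff (p ++ r) e ≈ coeff p e + coeff r e
    coeff-++ []            r e = sym (+-identityˡ _)
    coeff-++ ((a , d) ∷ p) r e = trans (+-congˡ (coeff-++ p r e)) (sym (+-assoc _ _ _))

    coeff-sum : ∀ {k} (f : Fin k → Poly n) e → coeff (sumₚ f) e ≈ sum (λ i → coeff (f i) e)
    coeff-sum {zero}  f e = refl
    coeff-sum {suc k} f e = trans (coeff-++ (f zero) (sumₚ (f ∘ suc)) e) (+-congˡ (coeff-sum (f ∘ suc) e))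

    exponents : Poly n → List (Exponent n)
    exponents = List.map proj₂

    tabulated : (Exponent n → Carrier) → List (Exponent n) → Poly n
    tabulated f = List.map λ e → f e , e

    evalWith-tabulated-+ : ∀ m f g ds →
      evalWith m (tabulated (λ e → f e + g e) ds) ≈ evalWith m (tabulated f ds) + evalWith m (tabulated g ds)
    evalWith-tabulated-+ m f g []       = sym (+-identityˡ 0#)
    evalWith-tabulated-+ m f g (d ∷ ds) =
      trans (+-cong (distribʳ (m d) (f d) (g d)) (evalWith-tabulated-+ m f g ds)) (interchange _ _ _ _)

    evalWith-tabulated-cong : ∀ {m m′ f f′} ds → (∀ e → f e * m e ≈ f′ e * m′ e) →
      evalWith m (tabulated f ds) ≈ evalWith m′ (tabulated f′ ds)
    evalWith-tabulated-cong []       eq = refl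
    evalWith-tabulated-cong (d ∷ ds) eq = +-cong (eq d) (evalWith-tabulated-cong ds eq)

    -- The contribution of one term to `coeff`: `coeff ((a , d) ∷ p) e` is
    -- `termAt a d e + coeff p e` by definition.
    termAt : Carrier → Exponent n → Exponent n → Carrier
    termAt a d e = if does (d ≟ᵉ e) then a else 0#

    evalWith-termAt-∉ : ∀ m a d ds → ListAll.All (d ≢_) ds → evalWith m (tabulated (termAt a d) ds) ≈ 0#
    evalWith-termAt-∉ m a d []       ListAll.[]          = refl
    evalWith-termAt-∉ m a d (e ∷ ds) (d≢e ListAll.∷ d∉) with d ≟ᵉ e
    ... | yes d≡e = contradiction d≡e d≢e
    ... | no  _   = trans (+-cong (zeroˡ _) (evalWith-termAt-∉ m a d ds d∉)) (+-identityˡ 0#)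

    evalWith-termAt : ∀ m a {d ds} → Unique ds → d ∈ ds → evalWith m (tabulated (termAt a d) ds) ≈ a * m d
    evalWith-termAt m a {d} {_ ∷ ds} (d∉ ∷ _) (here ≡.refl) with d ≟ᵉ d
    ... | yes _   = trans (+-congˡ (evalWith-termAt-∉ m a d ds d∉)) (+-identityʳ _)
    ... | no  d≢d = contradiction ≡.refl d≢d
    evalWith-termAt m a {d} {e ∷ ds} (e∉ ∷ u) (there d∈) with d ≟ᵉ e
    ... | yes ≡.refl = contradiction ≡.refl (ListAll.lookup e∉ d∈)
    ... | no  _      = trans (+-cong (zeroˡ _) (evalWith-termAt m a u d∈)) (+-identityˡ _)

    -- Each exponent of `p` occurs exactly once in `ds`, so every term is counted once. Allowing
    -- `ds` to be longer than necessary lets two polynomials be compared over a common list.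
    evalWith-collect : ∀ m p {ds} → Unique ds → (∀ {e} → e ∈ exponents p → e ∈ ds) →
      evalWith m p ≈ evalWith m (tabulated (coeff p) ds)
    evalWith-collect m []            {ds} u sub = sym (vanish ds)
      where
      vanish : ∀ ds → evalWith m (tabulated (coeff []) ds) ≈ 0#
      vanish []       = refl
      vanish (d ∷ ds) = trans (+-cong (zeroˡ _) (vanish ds)) (+-identityˡ 0#)
    evalWith-collect m ((a , d) ∷ p) {ds} u sub = begin
      a * m d + evalWith m p
        ≈⟨ +-cong (sym (evalWith-termAt m a u (sub (here ≡.refl)))) (evalWith-collect m p u (sub ∘ there)) ⟩
      evalWith m (tabulated (termAt a d) ds) + evalWith m (tabulated (coeff p) ds)
        ≈⟨ evalWith-tabulated-+ m (termAt a d) (coeff p) ds ⟨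
      evalWith m (tabulated (coeff ((a , d) ∷ p)) ds) ∎

    -- Comparing products `coeff p e * m e` instead of factors serves two purposes: equal
    -- polynomials under one weight, and one polynomial under two weights that differ only where its
    -- coefficient vanishes.
    evalWith-cong : ∀ {m m′} p p′ → (∀ e → coeff p e * m e ≈ coeff p′ e * m′ e) → evalWith m p ≈ evalWith m′ p′
    evalWith-cong {m} {m′} p p′ eq = begin
      evalWith m p                          ≈⟨ evalWith-collect m p u (λ e∈ → ∈-deduplicate⁺ _≟ᵉ_ (∈-++⁺ˡ e∈)) ⟩
      evalWith m (tabulated (coeff p) ds)   ≈⟨ evalWith-tabulated-cong ds eq ⟩
      evalWith m′ (tabulated (coeff p′) ds) ≈⟨ evalWith-collect m′ p′ u (λ e∈ → ∈-deduplicate⁺ _≟ᵉ_ (∈-++⁺ʳ (exponents p) e∈)) ⟨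
      evalWith m′ p′                        ∎
      where
      ds = deduplicate _≟ᵉ_ (exponents p ++ exponents p′)
      u  = deduplicate-! _≟ᵉ_ (exponents p ++ exponents p′)

  -- Evaluation at a point

  monomial : ∀ {n} → Vec Carrier n → Exponent n → Carrier
  monomial []       []       = 1#
  monomial (x ∷ xs) (d ∷ ds) = x ^ d * monomial xs ds

  monomial-+ : ∀ {n} (xs : Vec Carrier n) d e → monomial xs (zipWith ℕ._+_ d e) ≈ monomial xs d * monomial xs e
  monomial-+ []       []       []       = sym (*-identityˡ 1#)
  monomial-+ (x ∷ xs) (d ∷ ds) (e ∷ es) =
    trans (*-cong (^-homo-* x d e) (monomial-+ xs ds es)) (*-interchange _ _ _ _)

  monomial-0 : ∀ {n} (xs : Vec Carrier n) → monomial xs (replicate n 0) ≈ 1#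
  monomial-0 []       = refl
  monomial-0 (x ∷ xs) = trans (*-identityˡ _) (monomial-0 xs)

  monomial-unit : ∀ {n} (xs : Vec Carrier n) j → monomial xs (replicate n 0 [ j ]≔ 1) ≈ lookup xs j
  monomial-unit (x ∷ xs) zero    = trans (*-cong (*-identityʳ x) (monomial-0 xs)) (*-identityʳ x)
  monomial-unit (x ∷ xs) (suc j) = trans (*-identityˡ _) (monomial-unit xs j)

  tAt : ℕ → Carrier → Carrier
  tAt q y = y + sum {q ∸ 1} (λ i → y ^ toℕ i)

  tAt-cong : ∀ q {y z} → y ≈ z → tAt q y ≈ tAt q z
  tAt-cong q y≈z = +-cong y≈z (sum-cong-≋ {n = q ∸ 1} λ i → ^-congˡ (toℕ i) y≈z)

  module _ {n : ℕ} (xs : Vec Carrier n) where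

    open RawRing (polyRawRing n) using () renaming (_*_ to _*ₚ_; -_ to -ₚ_)
    open RawSemiringDefinitions (RawRing.rawSemiring (polyRawRing n)) using () renaming (_^_ to _^ₚ_; sum to sumₚ)

    eval : Poly n → Carrier
    eval = evalWith (monomial xs)

    eval-+ : ∀ p r → eval (p ++ r) ≈ eval p + eval r
    eval-+ = evalWith-++ (monomial xs)

    eval-* : ∀ p r → eval (p *ₚ r) ≈ eval p * eval r
    eval-* []            r = sym (zeroˡ _)
    eval-* ((a , d) ∷ p) r =
      trans (eval-+ (List.map (mulTerm (a , d)) r) _)
            (trans (+-cong (scale r) (eval-* p r)) (sym (distribʳ _ _ _)))
      where
      scale : ∀ r → eval (List.map (mulTerm (a , d)) r) ≈ a * monomial xs d * eval r
      scale []            = sym (zeroʳ _)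
      scale ((b , e) ∷ r) = trans
        (+-cong (trans (*-congˡ (monomial-+ xs d e)) (*-interchange _ _ _ _)) (scale r))
        (sym (distribˡ _ _ _))

    eval-neg : ∀ p → eval (-ₚ p) ≈ - eval p
    eval-neg []            = sym -0#≈0#
    eval-neg ((a , d) ∷ p) = trans (+-cong (sym (-‿distribˡ-* a _)) (eval-neg p)) (-‿+-comm _ _)

    eval-X : ∀ j → eval (X j) ≈ lookup xs j
    eval-X j = trans (+-identityʳ _) (trans (*-identityˡ _) (monomial-unit xs j))

    eval-^ : ∀ p k → eval (p ^ₚ k) ≈ eval p ^ k
    eval-^ p zero    = trans (+-identityʳ _) (trans (*-identityˡ _) (monomial-0 xs))
    eval-^ p (suc k) = trans (eval-* p (p ^ₚ k)) (*-congˡ (eval-^ p k))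

    eval-X^ : ∀ j k → eval (X j ^ₚ k) ≈ lookup xs j ^ k
    eval-X^ j k = trans (eval-^ (X j) k) (^-congˡ k (eval-X j))

    eval-cong : ∀ p p′ → p ≈ₚ p′ → eval p ≈ eval p′
    eval-cong p p′ eq = evalWith-cong p p′ λ e → *-congʳ (eq e)

    eval-congruent : ∀ {q p g} → (∀ x → x ^ q ≈ x) → CongruentModulo q p g → eval p ≈ eval g
    eval-congruent {q} {p} {g} fermat (h , eq) = begin
      eval p                            ≈⟨ eval-cong p (g ++ sumₚ gens) eq ⟩
      eval (g ++ sumₚ gens)             ≈⟨ eval-+ g (sumₚ gens) ⟩
      eval g + eval (sumₚ gens)         ≈⟨ +-congˡ (evalWith-sum _ gens) ⟩
      eval g + sum (λ j → eval (gens j)) ≈⟨ +-congˡ (sum-zero _ vanish) ⟩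
      eval g + 0#                       ≈⟨ +-identityʳ _ ⟩
      eval g                            ∎
      where
      gens : Fin n → Poly n
      gens j = h j *ₚ (X j ^ₚ q ++ -ₚ X j)
      vanish : ∀ j → eval (gens j) ≈ 0#
      vanish j = begin
        eval (gens j)                            ≈⟨ eval-* (h j) _ ⟩
        eval (h j) * eval (X j ^ₚ q ++ -ₚ X j)   ≈⟨ *-congˡ (eval-+ (X j ^ₚ q) (-ₚ X j)) ⟩
        eval (h j) * (eval (X j ^ₚ q) + eval (-ₚ X j))
          ≈⟨ *-congˡ (+-cong (trans (eval-X^ j q) (fermat _)) (trans (eval-neg (X j)) (-‿cong (eval-X j)))) ⟩
        eval (h j) * (lookup xs j - lookup xs j) ≈⟨ *-congˡ (-‿inverseʳ _) ⟩
        eval (h j) * 0#                          ≈⟨ zeroʳ _ ⟩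
        0#                                       ∎

    eval-t : ∀ q p → eval (t q p) ≈ tAt q (eval p)
    eval-t q p = trans (eval-+ p _) (+-congˡ (trans (evalWith-sum _ {q ∸ 1} (λ k → p ^ₚ toℕ k))
                                     (sum-cong-≋ {n = q ∸ 1} λ k → eval-^ p (toℕ k))))

    eval-f̄₃ : ∀ q i j k → eval (f̄₃ q (X i) (X j) (X k)) ≈
      tAt q (tAt q (lookup xs i ^ (q ∸ 4) + lookup xs j ^ (q ∸ 2)) + lookup xs k ^ (q ∸ 2))
    eval-f̄₃ q i j k = begin
      eval (f̄₃ q (X i) (X j) (X k))                  ≈⟨ eval-t q (f₂ ++ x₃) ⟩
      tAt q (eval (f₂ ++ x₃))                        ≈⟨ tAt-cong q (eval-+ f₂ x₃) ⟩
      tAt q (eval f₂ + eval x₃)                      ≈⟨ tAt-cong q (+-congʳ (eval-t q (x₁ ++ x₂))) ⟩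
      tAt q (tAt q (eval (x₁ ++ x₂)) + eval x₃)      ≈⟨ tAt-cong q (+-congʳ (tAt-cong q (eval-+ x₁ x₂))) ⟩
      tAt q (tAt q (eval x₁ + eval x₂) + eval x₃)    ≈⟨ tAt-cong q (+-cong
                                                          (tAt-cong q (+-cong (eval-X^ i (q ∸ 4)) (eval-X^ j (q ∸ 2))))
                                                          (eval-X^ k (q ∸ 2))) ⟩
      tAt q (tAt q (lookup xs i ^ (q ∸ 4) + lookup xs j ^ (q ∸ 2)) + lookup xs k ^ (q ∸ 2)) ∎
      where
      x₁ = X i ^ₚ (q ∸ 4)
      x₂ = X j ^ₚ (q ∸ 2)
      x₃ = X k ^ₚ (q ∸ 2)
      f₂ = f̄₂ q (X i) (X j)

  -- Congruence modulo the x_j^q - x_j and existence of reduced representatives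

  module _ {n : ℕ} (q : ℕ) where

    open RawRing (polyRawRing n) using () renaming (_*_ to _*ₚ_; -_ to -ₚ_)
    open RawSemiringDefinitions (RawRing.rawSemiring (polyRawRing n)) using () renaming (_^_ to _^ₚ_; sum to sumₚ)

    generator : Fin n → Poly n
    generator j = X j ^ₚ q ++ -ₚ X j

    combination : (Fin n → Poly n) → Poly n
    combination h = sumₚ λ j → h j *ₚ generator j

    coeff-combination-++ : ∀ h h′ e →
      coeff (combination λ j → h j ++ h′ j) e ≈ coeff (combination h) e + coeff (combination h′) e
    coeff-combination-++ h h′ e = begin
      coeff (combination λ j → h j ++ h′ j) e
        ≈⟨ coeff-sum (λ j → (h j ++ h′ j) *ₚ generator j) e ⟩
      sum (λ j → coeff ((h j ++ h′ j) *ₚ generator j) e)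
        ≈⟨ sum-cong-≋ {n = n} (λ j → trans
             (reflexive (≡.cong (λ p → coeff p e) (cartesianProductWith-distribʳ-++ mulTerm (h j) (h′ j) (generator j))))
             (coeff-++ (h j *ₚ generator j) (h′ j *ₚ generator j) e)) ⟩
      sum (λ j → coeff (h j *ₚ generator j) e + coeff (h′ j *ₚ generator j) e)
        ≈⟨ ∑-distrib-+ (λ j → coeff (h j *ₚ generator j) e) _ ⟩
      sum (λ j → coeff (h j *ₚ generator j) e) + sum (λ j → coeff (h′ j *ₚ generator j) e)
        ≈⟨ +-cong (coeff-sum (λ j → h j *ₚ generator j) e) (coeff-sum (λ j → h′ j *ₚ generator j) e) ⟨
      coeff (combination h) e + coeff (combination h′) e ∎

    congruent-refl : ∀ p → CongruentModulo q p p
    congruent-refl p = (λ _ → []) , λ e → sym (begin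
      coeff (p ++ combination (λ _ → [])) e        ≈⟨ coeff-++ p (combination (λ _ → [])) e ⟩
      coeff p e + coeff (combination (λ _ → [])) e ≈⟨ +-congˡ (coeff-sum (λ j → [] *ₚ generator j) e) ⟩
      coeff p e + sum {n} (λ _ → 0#)               ≈⟨ +-congˡ (sum-zero {n} _ λ _ → refl) ⟩
      coeff p e + 0#                               ≈⟨ +-identityʳ _ ⟩
      coeff p e                                    ∎)

    congruent-trans : ∀ p₁ p₂ p₃ → CongruentModulo q p₁ p₂ → CongruentModulo q p₂ p₃ → CongruentModulo q p₁ p₃
    congruent-trans p₁ p₂ p₃ (h , eq) (h′ , eq′) = (λ j → h′ j ++ h j) , λ e → begin
      coeff p₁ e                                                          ≈⟨ eq e ⟩
      coeff (p₂ ++ combination h) e                                       ≈⟨ coeff-++ p₂ (combination h) e ⟩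
      coeff p₂ e + coeff (combination h) e                                ≈⟨ +-congʳ (trans (eq′ e) (coeff-++ p₃ (combination h′) e)) ⟩
      coeff p₃ e + coeff (combination h′) e + coeff (combination h) e     ≈⟨ +-assoc _ _ _ ⟩
      coeff p₃ e + (coeff (combination h′) e + coeff (combination h) e)   ≈⟨ +-congˡ (coeff-combination-++ h′ h e) ⟨
      coeff p₃ e + coeff (combination λ j → h′ j ++ h j) e                ≈⟨ coeff-++ p₃ (combination λ j → h′ j ++ h j) e ⟨
      coeff (p₃ ++ combination λ j → h′ j ++ h j) e                       ∎

    congruent-++ : ∀ p₁ p₂ r₁ r₂ → CongruentModulo q p₁ p₂ → CongruentModulo q r₁ r₂ →
                   CongruentModulo q (p₁ ++ r₁) (p₂ ++ r₂)
    congruent-++ p₁ p₂ r₁ r₂ (h , eq) (h′ , eq′) = (λ j → h j ++ h′ j) , λ e → begin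
      coeff (p₁ ++ r₁) e
        ≈⟨ coeff-++ p₁ r₁ e ⟩
      coeff p₁ e + coeff r₁ e
        ≈⟨ +-cong (trans (eq e) (coeff-++ p₂ (combination h) e)) (trans (eq′ e) (coeff-++ r₂ (combination h′) e)) ⟩
      (coeff p₂ e + coeff (combination h) e) + (coeff r₂ e + coeff (combination h′) e)
        ≈⟨ interchange _ _ _ _ ⟩
      (coeff p₂ e + coeff r₂ e) + (coeff (combination h) e + coeff (combination h′) e)
        ≈⟨ +-cong (coeff-++ p₂ r₂ e) (coeff-combination-++ h h′ e) ⟨
      coeff (p₂ ++ r₂) e + coeff (combination λ j → h j ++ h′ j) e
        ≈⟨ coeff-++ (p₂ ++ r₂) (combination λ j → h j ++ h′ j) e ⟨
      coeff ((p₂ ++ r₂) ++ combination λ j → h j ++ h′ j) e ∎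

    -- The coefficient comes out as a product of ones, which is `1#` only up to `_≈_`. The shape of
    -- a single term is a propositional equality, so it can be used in a rewrite.
    X^-monomial : ∀ j k → ∃[ a ] a ≈ 1# × X j ^ₚ k ≡ (a , unit j k) ∷ []
    X^-monomial j zero    = 1# , refl , ≡.cong (λ e → (1# , e) ∷ []) (≡.sym (unit-0 j))
    X^-monomial j (suc k) with X^-monomial j k
    ... | a , a≈1 , eq = 1# * a , trans (*-identityˡ a) a≈1 ,
      ≡.trans (≡.cong (X j *ₚ_) eq) (≡.cong (λ e → (1# * a , e) ∷ []) (unit-+ j 1 k))

    -- The two monomials differ by `a x^u (x_j^q - x_j)`, so the only nonzero cofactor is the term
    -- `a x^u` at `j`.
    congruent-step : ∀ a u j →
      CongruentModulo q ((a , zipWith ℕ._+_ u (unit j q)) ∷ []) ((a , zipWith ℕ._+_ u (unit j 1)) ∷ [])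
    congruent-step a u j with X^-monomial j q
    ... | b , b≈1 , X^≡ = cofactor , λ e → sym (begin
      coeff (new ++ combination cofactor) e
        ≈⟨ coeff-++ new (combination cofactor) e ⟩
      coeff new e + coeff (combination cofactor) e
        ≈⟨ +-congˡ (trans (coeff-sum (λ i → cofactor i *ₚ generator i) e) (sum-single _ j λ i i≢j → off i i≢j e)) ⟩
      coeff new e + coeff (cofactor j *ₚ generator j) e
        ≈⟨ +-congˡ (on e) ⟩
      coeff new e + (coeff old e + - coeff new e)
        ≈⟨ +-congˡ (+-comm _ _) ⟩
      coeff new e + (- coeff new e + coeff old e)
        ≈⟨ +-assoc _ _ _ ⟨
      (coeff new e - coeff new e) + coeff old e
        ≈⟨ +-congʳ (-‿inverseʳ _) ⟩
      0# + coeff old e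
        ≈⟨ +-identityˡ _ ⟩
      coeff old e ∎)
      where
      old new : Poly n
      old = (a , zipWith ℕ._+_ u (unit j q)) ∷ []
      new = (a , zipWith ℕ._+_ u (unit j 1)) ∷ []

      cofactor : Fin n → Poly n
      cofactor i = if does (i Fin.≟ j) then (a , u) ∷ [] else []

      off : ∀ i → i ≢ j → ∀ e → coeff (cofactor i *ₚ generator i) e ≈ 0#
      off i i≢j e with i Fin.≟ j
      ... | yes i≡j = contradiction i≡j i≢j
      ... | no  _   = refl

      if-cong : ∀ bool {x y} → x ≈ y → (if bool then x else 0#) ≈ (if bool then y else 0#)
      if-cong false eq = refl
      if-cong true  eq = eq

      if-neg : ∀ bool x → (if bool then - x else 0#) ≈ - (if bool then x else 0#)
      if-neg false x = sym -0#≈0#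
      if-neg true  x = refl

      on : ∀ e → coeff (cofactor j *ₚ generator j) e ≈ coeff old e + - coeff new e
      on e with j Fin.≟ j
      ... | no  j≢j = contradiction ≡.refl j≢j
      ... | yes _ rewrite X^≡ = +-cong
        (trans (if-cong (does (zipWith ℕ._+_ u (unit j q) ≟ᵉ e)) (trans (*-congˡ b≈1) (*-identityʳ a)))
               (sym (+-identityʳ _)))
        (trans (+-identityʳ _) (trans
          (if-cong (does (zipWith ℕ._+_ u (unit j 1) ≟ᵉ e))
             (trans (*-comm a (- 1#)) (trans (sym (-‿distribˡ-* 1# a)) (-‿cong (*-identityˡ a)))))
          (trans (if-neg (does (zipWith ℕ._+_ u (unit j 1) ≟ᵉ e)) a) (-‿cong (sym (+-identityʳ _))))))

    module _ (1<q : 1 < q) where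

      -- Replacing `x_j^q` by `x_j` lowers the total degree by `q - 1`, which is positive because
      -- `1 < q`; this is the measure of the recursion.
      term-reduces : ∀ a d → Acc _<_ (Vec.sum d) →
        ∃[ d′ ] All (_< q) d′ × CongruentModulo q ((a , d) ∷ []) ((a , d′) ∷ [])
      term-reduces a d (acc rec) with reduced-or-divisible q d
      ... | inj₁ d<q = d , d<q , congruent-refl ((a , d) ∷ [])
      ... | inj₂ (u , j , ≡.refl) with term-reduces a (zipWith ℕ._+_ u (unit j 1)) (rec smaller)
        where
        smaller : Vec.sum (zipWith ℕ._+_ u (unit j 1)) < Vec.sum (zipWith ℕ._+_ u (unit j q))
        smaller = ≡.subst₂ _<_ (≡.sym (sum-+-unit u j 1)) (≡.sym (sum-+-unit u j q)) (ℕ.+-monoʳ-< (Vec.sum u) 1<q)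
      ...   | d′ , d′<q , cong = d′ , d′<q ,
        congruent-trans ((a , zipWith ℕ._+_ u (unit j q)) ∷ []) ((a , zipWith ℕ._+_ u (unit j 1)) ∷ []) ((a , d′) ∷ [])
                        (congruent-step a u j) cong

      reduced-representative : ∀ p → ∃[ g ] IsReducedRepresentative q p g
      reduced-representative []            = [] , (λ e 0≉0 → contradiction refl 0≉0) , congruent-refl []
      reduced-representative ((a , d) ∷ p)
        with term-reduces a d (<-wellFounded _) | reduced-representative p
      ... | d′ , d′<q , cong | g , reduced , cong′ = (a , d′) ∷ g , reduced′ , congruent-++ ((a , d) ∷ []) ((a , d′) ∷ []) p g cong cong′
        where
        reduced′ : IsReduced q ((a , d′) ∷ g)
        reduced′ e ≉0 with d′ ≟ᵉ e
        ... | yes ≡.refl = d′<q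
        ... | no  _      = reduced e λ ≈0 → ≉0 (trans (+-identityˡ _) ≈0)

-- Finite fields: Fermat's theorem, roots of polynomials and power sums

NonzeroInvertible : ∀ {c ℓ} → CommutativeRing c ℓ → Set (c ⊔ ℓ)
NonzeroInvertible R = ∀ x → ¬ x ≈ 0# → ∃[ y ] x * y ≈ 1#
  where open CommutativeRing R

module FiniteField {c ℓ} (R : CommutativeRing c ℓ)
  (n : ℕ) (enumeration : Inverse (CommutativeRing.setoid R) (≡.setoid (Fin (2 ℕ.+ n))))
  (invertible : NonzeroInvertible R) where

  open CommutativeRing R hiding (zero)
  open import Algebra.Properties.Ring ring
    using (x∙y⁻¹≈ε⇒x≈y; x≈y⇒x∙y⁻¹≈ε; [y-z]x≈yx-zx; +-identityʳ-unique; +-inverseˡ-unique; -0#≈0#; -‿injective; -‿involutive; -1*x≈-x)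
  open import Algebra.Properties.CommutativeSemiring.Exp commutativeSemiring
  open import Algebra.Properties.Semiring.Mult semiring using (×1-homo-*; ×-homo-1) renaming (_×_ to _·_)
  open import Algebra.Properties.Semiring.Sum semiring using (sum; sum-cong-≋; *-distribˡ-sum; sum-replicate; ∑-comm)
  open import Algebra.Properties.CommutativeMonoid.Sum *-commutativeMonoid
    using () renaming (sum to product; sum-replicate to product-replicate)
  open import Algebra.Solver.Ring.NaturalCoefficients.Default commutativeSemiring using (solve; _:+_; _:*_; _:=_; con)
  open import Relation.Binary.Reasoning.Setoid setoid
  open Inverse enumeration using (to; from; to-cong; strictlyInverseˡ)
  open FiniteSums.OverCarrier +-commutativeMonoid enumeration public using (∑; ∑≈sum; ∑-cong; ∑-permute; ∑-single) renaming (∑-∙ to ∑-+)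
  private module ∏ = FiniteSums.OverCarrier *-commutativeMonoid enumeration

  infix 4 _≟_
  opaque
    _≟_ : Decidable _≈_
    _≟_ = via-injection (Inverse⇒Injection enumeration) Fin._≟_

  from-injective : ∀ {i j} → from i ≈ from j → i ≡ j
  from-injective {i} {j} eq = ≡.trans (≡.sym (strictlyInverseˡ i)) (≡.trans (to-cong eq) (strictlyInverseˡ j))

  1≉0 : ¬ 1# ≈ 0#
  1≉0 1≈0 with from-injective {0F} {1F} (trans (≈0 _) (sym (≈0 _)))
    where
    ≈0 : ∀ x → x ≈ 0#
    ≈0 x = trans (sym (*-identityʳ x)) (trans (*-congˡ 1≈0) (zeroʳ x))
  ... | ()

  *-cancelˡ : ∀ {x y z} → ¬ x ≈ 0# → x * y ≈ x * z → y ≈ z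
  *-cancelˡ {x} {y} {z} x≉0 eq with invertible x x≉0
  ... | w , xw≈1 = begin
    y           ≈⟨ unfold y ⟩
    w * (x * y) ≈⟨ *-congˡ eq ⟩
    w * (x * z) ≈⟨ unfold z ⟨
    z           ∎
    where
    unfold : ∀ y → y ≈ w * (x * y)
    unfold y = trans (trans (sym (*-identityˡ y)) (*-congʳ (trans (sym xw≈1) (*-comm x w)))) (*-assoc w x y)

  no-zero-divisors : ∀ {x y} → ¬ x ≈ 0# → x * y ≈ 0# → y ≈ 0#
  no-zero-divisors {x} x≉0 eq = *-cancelˡ x≉0 (trans eq (sym (zeroʳ x)))

  at : Carrier → Carrier → Carrier → Carrier → Carrier
  at a u v x = if does (x ≟ a) then u else v

  at-≈ : ∀ {a x} u v → x ≈ a → at a u v x ≈ u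
  at-≈ {a} {x} u v x≈a with x ≟ a
  ... | yes _  = refl
  ... | no x≉a = contradiction x≈a x≉a

  at-≉ : ∀ {a x} u v → ¬ x ≈ a → at a u v x ≈ v
  at-≉ {a} {x} u v x≉a with x ≟ a
  ... | yes x≈a = contradiction x≈a x≉a
  ... | no  _   = refl

  at-cong : ∀ a u v → Congruent _≈_ _≈_ (at a u v)
  at-cong a u v {x} {y} x≈y with y ≟ a
  ... | yes y≈a = at-≈ u v (trans x≈y y≈a)
  ... | no  y≉a = at-≉ u v λ x≈a → y≉a (trans (sym x≈y) x≈a)

  *-∑ : ∀ a f → a * ∑ f ≈ ∑ (λ x → a * f x)
  *-∑ a f = trans (*-congˡ (∑≈sum f)) (trans (*-distribˡ-sum a (λ i → f (from i))) (sym (∑≈sum _)))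

  ∑-* : ∀ a f → ∑ (λ x → f x * a) ≈ ∑ f * a
  ∑-* a f = trans (∑-cong λ x → *-comm (f x) a) (trans (sym (*-∑ a f)) (*-comm a _))

  ∑-swap : ∀ (f : Carrier → Carrier → Carrier) → ∑ (λ x → ∑ λ y → f x y) ≈ ∑ (λ y → ∑ λ x → f x y)
  ∑-swap f = trans (nested f) (trans (∑-comm (λ i j → f (from i) (from j))) (sym (nested λ y x → f x y)))
    where
    nested : ∀ (f : Carrier → Carrier → Carrier) →
             ∑ (λ x → ∑ λ y → f x y) ≈ sum (λ i → sum λ j → f (from i) (from j))
    nested f = trans (∑≈sum _) (sum-cong-≋ {n = 2 ℕ.+ n} λ i → ∑≈sum (f (from i)))

  ∑-zero : ∀ {f} → (∀ x → f x ≈ 0#) → ∑ f ≈ 0#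
  ∑-zero f≈0 = trans (∑≈sum _) (FiniteSums.sum-ε +-commutativeMonoid _ (f≈0 ∘ from))

  permutation : ∀ (f g : Carrier → Carrier) → Congruent _≈_ _≈_ f → Congruent _≈_ _≈_ g →
                (∀ x → f (g x) ≈ x) → (∀ x → g (f x) ≈ x) → Inverse setoid setoid
  permutation f g f-cong g-cong fg gf = record
    { to = f ; from = g ; to-cong = f-cong ; from-cong = g-cong
    ; inverse = (λ eq → trans (f-cong eq) (fg _)) , (λ eq → trans (g-cong eq) (gf _)) }

  translation : Carrier → Inverse setoid setoid
  translation a = permutation (_+ a) (_- a) +-congʳ +-congʳ
    (λ x → trans (+-assoc x _ a) (trans (+-congˡ (-‿inverseˡ a)) (+-identityʳ x)))
    (λ x → trans (+-assoc x a _) (trans (+-congˡ (-‿inverseʳ a)) (+-identityʳ x)))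

  scaling : ∀ a → ¬ a ≈ 0# → Inverse setoid setoid
  scaling a a≉0 with invertible a a≉0
  ... | b , ab≈1 = permutation (a *_) (b *_) *-congˡ *-congˡ
    (λ x → trans (sym (*-assoc a b x)) (trans (*-congʳ ab≈1) (*-identityˡ x)))
    (λ x → trans (sym (*-assoc b a x)) (trans (*-congʳ (trans (*-comm b a) ab≈1)) (*-identityˡ x)))

  ∑-translate : ∀ {f} → Congruent _≈_ _≈_ f → ∀ a → ∑ (λ x → f (x + a)) ≈ ∑ f
  ∑-translate f-cong a = ∑-permute (translation a) f-cong

  ∑-scale : ∀ {f} → Congruent _≈_ _≈_ f → ∀ {a} → ¬ a ≈ 0# → ∑ (λ x → f (a * x)) ≈ ∑ f
  ∑-scale f-cong {a} a≉0 = ∑-permute (scaling a a≉0) f-cong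

  -- Translation by `a` permutes the field, so the sum of all `x + a` equals the sum of all `x`.
  ∑-const : ∀ a → ∑ (λ _ → a) ≈ 0#
  ∑-const a = +-identityʳ-unique (∑ λ x → x) _
    (trans (sym (∑-+ (λ x → x) (λ _ → a))) (∑-translate (λ eq → eq) a))

  product-nonzero : ∀ {k} (f : Fin k → Carrier) → (∀ i → ¬ f i ≈ 0#) → ¬ product f ≈ 0#
  product-nonzero {zero}  f f≉0 = 1≉0
  product-nonzero {suc k} f f≉0 = product-nonzero (f ∘ suc) (f≉0 ∘ suc) ∘ no-zero-divisors (f≉0 zero)

  -- For `x` nonzero, `x^q` is the product of the constant `x` over all `q` elements. Splitting off
  -- the factor at 0 leaves a product equal to 1, because multiplication by `x` permutes the nonzero
  -- elements and preserves their product.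
  x^q≈x : ∀ x → x ^ (2 ℕ.+ n) ≈ x
  x^q≈x x with x ≟ 0#
  ... | yes x≈0 = trans (trans (*-congʳ x≈0) (zeroˡ _)) (sym x≈0)
  ... | no  x≉0 = begin
    x ^ (2 ℕ.+ n)                           ≈⟨ trans (∏.∑≈sum _) (product-replicate (2 ℕ.+ n)) ⟨
    ∏.∑ (λ _ → x)                           ≈⟨ ∏.∑-cong split ⟩
    ∏.∑ (λ y → at 0# x 1# y * at 0# 1# x y) ≈⟨ ∏.∑-∙ (at 0# x 1#) (at 0# 1# x) ⟩
    ∏.∑ (at 0# x 1#) * ∏.∑ (at 0# 1# x)     ≈⟨ *-cong at-0 units ⟩
    x * 1#                                  ≈⟨ *-identityʳ x ⟩
    x                                       ∎
    where
    -- With 0 replaced by 1, the product of `g` over the whole field is the product of the nonzero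
    -- elements, and it can be cancelled.
    g : Carrier → Carrier
    g y = at 0# 1# y y

    g-cong : Congruent _≈_ _≈_ g
    g-cong {y} {z} y≈z with z ≟ 0#
    ... | yes z≈0 = at-≈ 1# y (trans y≈z z≈0)
    ... | no  z≉0 = trans (at-≉ 1# y λ y≈0 → z≉0 (trans (sym y≈z) y≈0)) y≈z

    g≉0 : ∀ y → ¬ g y ≈ 0#
    g≉0 y with y ≟ 0#
    ... | yes _  = 1≉0
    ... | no y≉0 = y≉0

    split : ∀ y → x ≈ at 0# x 1# y * at 0# 1# x y
    split y with y ≟ 0#
    ... | yes _ = sym (*-identityʳ x)
    ... | no  _ = sym (*-identityˡ x)

    at-0 : ∏.∑ (at 0# x 1#) ≈ x
    at-0 = trans (∏.∑-single (at-cong 0# x 1#) 0# (λ y y≉0 → at-≉ x 1# y≉0)) (at-≈ x 1# refl)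

    g-scale : ∀ y → g y * at 0# 1# x y ≈ g (x * y)
    g-scale y with y ≟ 0#
    ... | yes y≈0 = trans (*-identityʳ 1#) (sym (at-≈ 1# (x * y) (trans (*-congˡ y≈0) (zeroʳ x))))
    ... | no  y≉0 = trans (*-comm y x) (sym (at-≉ 1# (x * y) (y≉0 ∘ no-zero-divisors x≉0)))

    units : ∏.∑ (at 0# 1# x) ≈ 1#
    units = *-cancelˡ (product-nonzero _ (g≉0 ∘ from) ∘ trans (sym (∏.∑≈sum g))) (begin
      ∏.∑ g * ∏.∑ (at 0# 1# x)         ≈⟨ ∏.∑-∙ g (at 0# 1# x) ⟨
      ∏.∑ (λ y → g y * at 0# 1# x y)   ≈⟨ ∏.∑-cong g-scale ⟩
      ∏.∑ (λ y → g (x * y))            ≈⟨ ∏.∑-permute (scaling x x≉0) g-cong ⟩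
      ∏.∑ g                            ≈⟨ *-identityʳ _ ⟨
      ∏.∑ g * 1#                       ∎)

  x^[q-1]≈1 : ∀ {x} → ¬ x ≈ 0# → x ^ (1 ℕ.+ n) ≈ 1#
  x^[q-1]≈1 {x} x≉0 = *-cancelˡ x≉0 (trans (x^q≈x x) (sym (*-identityʳ x)))

  -- Horner form of the monic polynomial of degree `m` whose lower coefficients, constant term
  -- first, are listed. The leading 1 is built in, so the zero polynomial is excluded.
  monicAt : ∀ {m} → Vec Carrier m → Carrier → Carrier
  monicAt []       x = 1#
  monicAt (a ∷ as) x = a + x * monicAt as x

  -- Synthetic division by `x - r`: the coefficients below the leading one are the values at `r` of
  -- the successive Horner tails.
  quotient : ∀ {m} → Carrier → Vec Carrier (suc m) → Vec Carrier m
  quotient         r (a ∷ [])         = []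
  quotient {suc m} r (a ∷ as@(_ ∷ _)) = monicAt as r ∷ quotient r as

  -- as(x) − as(r) = (x − r) · quotient(x), with the negative terms moved across.
  quotient-correct : ∀ {m} (as : Vec Carrier (suc m)) r x →
    monicAt as x + r * monicAt (quotient r as) x ≈ x * monicAt (quotient r as) x + monicAt as r
  quotient-correct (a ∷ []) r x =
    solve 3 (λ a r x → (a :+ x :* con 1) :+ r :* con 1 := x :* con 1 :+ (a :+ r :* con 1)) refl a r x
  quotient-correct {suc m} (a ∷ as@(_ ∷ _)) r x = begin
    (a + x * P) + r * (P′ + x * Q)
      ≈⟨ solve 6 (λ a r x P P′ Q → (a :+ x :* P) :+ r :* (P′ :+ x :* Q) := (a :+ r :* P′) :+ x :* (P :+ r :* Q)) refl a r x P P′ Q ⟩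
    (a + r * P′) + x * (P + r * Q)
      ≈⟨ +-congˡ (*-congˡ (quotient-correct as r x)) ⟩
    (a + r * P′) + x * (x * Q + P′)
      ≈⟨ solve 5 (λ a r x P′ Q → (a :+ r :* P′) :+ x :* (x :* Q :+ P′) := x :* (P′ :+ x :* Q) :+ (a :+ r :* P′)) refl a r x P′ Q ⟩
    x * (P′ + x * Q) + (a + r * P′) ∎
    where
    P  = monicAt as x
    P′ = monicAt as r
    Q  = monicAt (quotient r as) x

  -- Dividing by `x - r` for one root `r` lowers the degree, and the quotient vanishes at the other
  -- roots since `x - r` is nonzero there. In degree 0 the polynomial is the constant 1.
  too-many-roots : ∀ {m} (as : Vec Carrier m) (roots : Fin (suc m) → Carrier) →
    (∀ {i j} → roots i ≈ roots j → i ≡ j) → ¬ (∀ i → monicAt as (roots i) ≈ 0#)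
  too-many-roots {zero}  []  roots injective vanish = 1≉0 (vanish zero)
  too-many-roots {suc m} as  roots injective vanish =
    too-many-roots (quotient r as) (roots ∘ suc) (Fin.suc-injective ∘ injective) vanish′
    where
    r = roots zero
    vanish′ : ∀ i → monicAt (quotient r as) (roots (suc i)) ≈ 0#
    vanish′ i = no-zero-divisors x-r≉0 (begin
      (x - r) * Q   ≈⟨ [y-z]x≈yx-zx Q x r ⟩
      x * Q - r * Q ≈⟨ x≈y⇒x∙y⁻¹≈ε x*Q≈r*Q ⟩
      0#            ∎)
      where
      x = roots (suc i)
      Q = monicAt (quotient r as) x
      x-r≉0 : ¬ x - r ≈ 0#
      x-r≉0 eq with injective (x∙y⁻¹≈ε⇒x≈y x r eq)
      ... | ()
      x*Q≈r*Q : x * Q ≈ r * Q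
      x*Q≈r*Q = begin
        x * Q                 ≈⟨ +-identityʳ _ ⟨
        x * Q + 0#            ≈⟨ +-congˡ (vanish zero) ⟨
        x * Q + monicAt as r  ≈⟨ quotient-correct as r x ⟨
        monicAt as x + r * Q  ≈⟨ +-congʳ (vanish (suc i)) ⟩
        0# + r * Q            ≈⟨ +-identityˡ _ ⟩
        r * Q                 ∎

  monicAt-replicate-0 : ∀ m x → monicAt (replicate m 0#) x ≈ x ^ m
  monicAt-replicate-0 zero    x = refl
  monicAt-replicate-0 (suc m) x = trans (+-identityˡ _) (*-congˡ (monicAt-replicate-0 m x))

  -- Otherwise `x^(k+2) - x` would vanish on the whole field, 0 included, and already `k + 3`
  -- elements, of which there are enough, exceed its degree. Searching the enumeration decides
  -- between the alternatives.
  ∃-power≉1 : ∀ k → suc k < suc n → ∃[ x ] ¬ x ≈ 0# × ¬ x ^ suc k ≈ 1#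
  ∃-power≉1 k k<n with Fin.any? (λ i → ¬? (from i ≟ 0#) ×-dec ¬? (from i ^ suc k ≟ 1#))
  ... | yes (i , x≉0 , x^≉1) = from i , x≉0 , x^≉1
  ... | no  none = contradiction vanish
      (too-many-roots polynomial roots λ eq → Fin.inject≤-injective k+3≤q k+3≤q _ _ (from-injective eq))
    where
    polynomial : Vec Carrier (2 ℕ.+ k)
    polynomial = 0# ∷ - 1# ∷ replicate k 0#
    k+3≤q : 3 ℕ.+ k ≤ 2 ℕ.+ n
    k+3≤q = s≤s k<n
    roots : Fin (3 ℕ.+ k) → Carrier
    roots i = from (Fin.inject≤ i k+3≤q)
    vanish : ∀ i → monicAt polynomial (roots i) ≈ 0#
    vanish i with roots i ≟ 0#
    ... | yes x≈0 = trans (+-identityˡ _) (trans (*-congʳ x≈0) (zeroˡ _))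
    ... | no  x≉0 = trans (+-identityˡ _) (trans (*-congˡ (begin
      - 1# + roots i * monicAt (replicate k 0#) (roots i) ≈⟨ +-congˡ (*-congˡ (monicAt-replicate-0 k _)) ⟩
      - 1# + roots i ^ suc k                              ≈⟨ +-congˡ power≈1 ⟩
      - 1# + 1#                                           ≈⟨ -‿inverseˡ 1# ⟩
      0#                                                  ∎)) (zeroʳ _))
      where
      power≈1 : roots i ^ suc k ≈ 1#
      power≈1 = decidable-stable (_ ≟ _) λ x^≉1 → none (Fin.inject≤ i k+3≤q , x≉0 , x^≉1)

  powerSum : ℕ → Carrier
  powerSum k = ∑ (_^ k)

  -- For positive `k`, scaling the variable by `a` permutes the summands and multiplies the sum by
  -- `a^k`; some nonzero `a` has `a^k` different from 1.
  powerSum-small : ∀ k → k < suc n → powerSum k ≈ 0#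
  powerSum-small zero    _   = ∑-const 1#
  powerSum-small (suc k) k<n with ∃-power≉1 k k<n
  ... | a , a≉0 , a^≉1 = no-zero-divisors (a^≉1 ∘ x∙y⁻¹≈ε⇒x≈y _ _) (begin
    (a ^ suc k - 1#) * powerSum (suc k)                     ≈⟨ [y-z]x≈yx-zx _ _ _ ⟩
    a ^ suc k * powerSum (suc k) - 1# * powerSum (suc k)    ≈⟨ x≈y⇒x∙y⁻¹≈ε (begin
      a ^ suc k * powerSum (suc k)      ≈⟨ *-∑ (a ^ suc k) (_^ suc k) ⟩
      ∑ (λ x → a ^ suc k * x ^ suc k)   ≈⟨ ∑-cong (λ x → ^-distrib-* a x (suc k)) ⟨
      ∑ (λ x → (a * x) ^ suc k)         ≈⟨ ∑-scale (^-congˡ (suc k)) a≉0 ⟩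
      powerSum (suc k)                  ≈⟨ *-identityˡ _ ⟨
      1# * powerSum (suc k)             ∎) ⟩
    0#                                                      ∎)

  -- `x^(q-1)` is 1 except at 0; adding the indicator of 0 gives the constant 1, whose sum vanishes.
  powerSum-[q-1] : powerSum (1 ℕ.+ n) ≈ - 1#
  powerSum-[q-1] = +-inverseˡ-unique _ 1# (begin
    powerSum (1 ℕ.+ n) + 1#                     ≈⟨ +-congˡ (trans (∑-single (at-cong 0# 1# 0#) 0# (λ x → at-≉ 1# 0#)) (at-≈ 1# 0# refl)) ⟨
    powerSum (1 ℕ.+ n) + ∑ (at 0# 1# 0#)        ≈⟨ ∑-+ (_^ (1 ℕ.+ n)) (at 0# 1# 0#) ⟨
    ∑ (λ x → x ^ (1 ℕ.+ n) + at 0# 1# 0# x)     ≈⟨ ∑-cong pointwise ⟩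
    ∑ (λ _ → 1#)                                ≈⟨ ∑-const 1# ⟩
    0#                                          ∎)
    where
    pointwise : ∀ x → x ^ (1 ℕ.+ n) + at 0# 1# 0# x ≈ 1#
    pointwise x with x ≟ 0#
    ... | yes x≈0 = trans (+-congʳ (trans (*-congʳ x≈0) (zeroˡ _))) (+-identityˡ 1#)
    ... | no  x≉0 = trans (+-identityʳ _) (x^[q-1]≈1 x≉0)

  -- The exponent starts at 1 because `x^0` and `x^(q-1)` differ at 0.
  powerSum-periodic : ∀ k → powerSum (suc k ℕ.+ suc n) ≈ powerSum (suc k)
  powerSum-periodic k = ∑-cong λ x → begin
    x ^ (suc k ℕ.+ suc n)  ≡⟨ ≡.cong (x ^_) (≡.sym (ℕ.+-suc k (suc n))) ⟩
    x ^ (k ℕ.+ (2 ℕ.+ n))  ≈⟨ ^-homo-* x k (2 ℕ.+ n) ⟩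
    x ^ k * x ^ (2 ℕ.+ n)  ≈⟨ *-congˡ (x^q≈x x) ⟩
    x ^ k * x              ≈⟨ *-comm _ x ⟩
    x ^ suc k              ∎

  -- For `e < a` the exponent is below `q - 1`. For `e > a` it is `(q - 1) + (e - a)`, and
  -- periodicity leaves `e - a`, which is strictly between 0 and `q - 1` because `a` is positive.
  powerSum-off-diagonal : ∀ {e a b} → a ℕ.+ b ≡ suc n → 0 < a → e < 2 ℕ.+ n → e ≢ a → powerSum (e ℕ.+ b) ≈ 0#
  powerSum-off-diagonal {e} {a} {b} a+b≡ 0<a (s≤s e≤) e≢a with ℕ.<-cmp e a
  ... | tri< e<a _ _ = powerSum-small _ (≡.subst (e ℕ.+ b <_) a+b≡ (ℕ.+-monoˡ-< b e<a))
  ... | tri≈ _ e≡a _ = contradiction e≡a e≢a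
  ... | tri> _ _ a<e with ℕ.m≤n⇒∃[o]m+o≡n a<e
  ...   | k , ≡.refl = begin
    powerSum (suc a ℕ.+ k ℕ.+ b)  ≡⟨ ≡.cong (λ m → powerSum (m ℕ.+ b)) (ℕ.+-comm (suc a) k) ⟩
    powerSum (k ℕ.+ suc a ℕ.+ b)  ≡⟨ ≡.cong powerSum (ℕ.+-assoc k (suc a) b) ⟩
    powerSum (k ℕ.+ suc (a ℕ.+ b)) ≡⟨ ≡.cong powerSum (ℕ.+-suc k (a ℕ.+ b)) ⟩
    powerSum (suc k ℕ.+ (a ℕ.+ b)) ≡⟨ ≡.cong (λ m → powerSum (suc k ℕ.+ m)) a+b≡ ⟩
    powerSum (suc k ℕ.+ suc n)    ≈⟨ powerSum-periodic k ⟩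
    powerSum (suc k)              ≈⟨ powerSum-small (suc k) (ℕ.<-≤-trans (s≤s (ℕ.m<n+m k 0<a)) e≤) ⟩
    0#                            ∎

  -- The sum of 1 over the field is `p^r · 1`, and it vanishes; in the absence of zero divisors the
  -- factor `p · 1` vanishes.
  characteristic : ∀ p r → p ℕ.^ r ≡ 2 ℕ.+ n → p · 1# ≈ 0#
  characteristic p r eq = prime-power r (trans (reflexive (≡.cong (_· 1#) eq)) (trans (sym (trans (∑≈sum _) (sum-replicate (2 ℕ.+ n)))) (∑-const 1#)))
    where
    prime-power : ∀ r → (p ℕ.^ r) · 1# ≈ 0# → p · 1# ≈ 0#
    prime-power zero    1≈0 = contradiction (trans (sym (×-homo-1 1#)) 1≈0) 1≉0
    prime-power (suc r) p*≈0 with p · 1# ≟ 0#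
    ... | yes p≈0 = p≈0
    ... | no  p≉0 = prime-power r (no-zero-divisors p≉0 (trans (sym (×1-homo-* p (p ℕ.^ r))) p*≈0))

  -- Coefficients of a reduced form as moments of its values

  open Polynomials rawRing using (Exponent; coeff; IsReducedRepresentative)
  open FormalSums R using (evalWith; evalWith-cong; evalWith-indicator; indicator; indicator-refl; indicator-≢;
                           monomial; eval; eval-congruent)

  evalWith-∑ : ∀ {N} (m : Carrier → Exponent N → Carrier) p →
    evalWith (λ e → ∑ λ x → m x e) p ≈ ∑ (λ x → evalWith (m x) p)
  evalWith-∑ m []            = sym (∑-const 0#)
  evalWith-∑ m ((a , d) ∷ p) = begin
    a * ∑ (λ x → m x d) + evalWith (λ e → ∑ λ x → m x e) p    ≈⟨ +-cong (*-∑ a λ x → m x d) (evalWith-∑ m p) ⟩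
    ∑ (λ x → a * m x d) + ∑ (λ x → evalWith (m x) p)          ≈⟨ ∑-+ (λ x → a * m x d) (λ x → evalWith (m x) p) ⟨
    ∑ (λ x → a * m x d + evalWith (m x) p)                    ∎

  evalWith-* : ∀ {N} (m : Exponent N → Carrier) w p → evalWith (λ e → m e * w) p ≈ evalWith m p * w
  evalWith-* m w []            = sym (zeroˡ w)
  evalWith-* m w ((a , d) ∷ p) = begin
    a * (m d * w) + evalWith (λ e → m e * w) p ≈⟨ +-cong (sym (*-assoc a (m d) w)) (evalWith-* m w p) ⟩
    a * m d * w + evalWith m p * w             ≈⟨ distribʳ w _ _ ⟨
    (a * m d + evalWith m p) * w               ∎

  ∑-product : ∀ f g h → ∑ (λ x → ∑ λ y → ∑ λ z → f x * (g y * h z)) ≈ ∑ f * (∑ g * ∑ h)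
  ∑-product f g h = begin
    ∑ (λ x → ∑ λ y → ∑ λ z → f x * (g y * h z))  ≈⟨ ∑-cong (λ x → ∑-cong λ y → *-∑ (f x) λ z → g y * h z) ⟨
    ∑ (λ x → ∑ λ y → f x * ∑ λ z → g y * h z)    ≈⟨ ∑-cong (λ x → ∑-cong λ y → *-congˡ (*-∑ (g y) h)) ⟨
    ∑ (λ x → ∑ λ y → f x * (g y * ∑ h))          ≈⟨ ∑-cong (λ x → *-∑ (f x) λ y → g y * ∑ h) ⟨
    ∑ (λ x → f x * ∑ λ y → g y * ∑ h)            ≈⟨ ∑-cong (λ x → *-congˡ (∑-* (∑ h) g)) ⟩
    ∑ (λ x → f x * (∑ g * ∑ h))                  ≈⟨ ∑-* (∑ g * ∑ h) f ⟩
    ∑ f * (∑ g * ∑ h)                            ∎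

  moment : (Carrier → Carrier → Carrier → Carrier) → ℕ → ℕ → ℕ → Carrier
  moment F b₁ b₂ b₃ = ∑ λ x → ∑ λ y → ∑ λ z → F x y z * (x ^ b₁ * (y ^ b₂ * z ^ b₃))

  moment-cong : ∀ {F G} → (∀ x y z → F x y z ≈ G x y z) → ∀ b₁ b₂ b₃ → moment F b₁ b₂ b₃ ≈ moment G b₁ b₂ b₃
  moment-cong eq b₁ b₂ b₃ = ∑-cong λ x → ∑-cong λ y → ∑-cong λ z → *-congʳ (eq x y z)

  -- One factor Σ_x x^(q−1) = −1 for each of the three variables.
  κ : Carrier
  κ = - 1# * (- 1# * - 1#)

  κ≉0 : ¬ κ ≈ 0#
  κ≉0 κ≈0 = 1≉0 (-‿injective (trans (sym κ≈-1) (trans κ≈0 (sym -0#≈0#))))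
    where
    κ≈-1 : κ ≈ - 1#
    κ≈-1 = trans (*-congˡ (trans (-1*x≈-x _) (-‿involutive 1#))) (*-identityʳ _)

  -- The moment of a monomial is a product of three power sums: `κ` at the exponent `a`, and 0 at
  -- every other reduced exponent. The moments of `g` and `p` coincide because congruent polynomials
  -- have the same values.
  coefficient-moment : ∀ {p g} → IsReducedRepresentative {3} (2 ℕ.+ n) p g →
    ∀ {a₁ a₂ a₃ b₁ b₂ b₃} → a₁ ℕ.+ b₁ ≡ suc n → a₂ ℕ.+ b₂ ≡ suc n → a₃ ℕ.+ b₃ ≡ suc n → 0 < a₁ → 0 < a₂ → 0 < a₃ →
    coeff g (a₁ ∷ a₂ ∷ a₃ ∷ []) * κ ≈ moment (λ x y z → eval (x ∷ y ∷ z ∷ []) p) b₁ b₂ b₃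
  coefficient-moment {p} {g} (reduced , congruent) {a₁} {a₂} {a₃} {b₁} {b₂} {b₃} eq₁ eq₂ eq₃ 0<a₁ 0<a₂ 0<a₃ = begin
    coeff g a * κ
      ≈⟨ evalWith-indicator a κ g ⟨
    evalWith (indicator a κ) g
      ≈⟨ evalWith-cong g g orthogonality ⟩
    evalWith (λ e → ∑ λ x → ∑ λ y → ∑ λ z → m x y z e * w x y z) g
      ≈⟨ evalWith-∑ (λ x e → ∑ λ y → ∑ λ z → m x y z e * w x y z) g ⟩
    ∑ (λ x → evalWith (λ e → ∑ λ y → ∑ λ z → m x y z e * w x y z) g)
      ≈⟨ ∑-cong (λ x → evalWith-∑ (λ y e → ∑ λ z → m x y z e * w x y z) g) ⟩
    ∑ (λ x → ∑ λ y → evalWith (λ e → ∑ λ z → m x y z e * w x y z) g)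
      ≈⟨ ∑-cong (λ x → ∑-cong λ y → evalWith-∑ (λ z e → m x y z e * w x y z) g) ⟩
    ∑ (λ x → ∑ λ y → ∑ λ z → evalWith (λ e → m x y z e * w x y z) g)
      ≈⟨ ∑-cong (λ x → ∑-cong λ y → ∑-cong λ z → evalWith-* (m x y z) (w x y z) g) ⟩
    moment (λ x y z → eval (x ∷ y ∷ z ∷ []) g) b₁ b₂ b₃
      ≈⟨ moment-cong (λ x y z → eval-congruent (x ∷ y ∷ z ∷ []) {2 ℕ.+ n} {p} {g} x^q≈x congruent) b₁ b₂ b₃ ⟨
    moment (λ x y z → eval (x ∷ y ∷ z ∷ []) p) b₁ b₂ b₃ ∎
    where
    a = a₁ ∷ a₂ ∷ a₃ ∷ []
    m : Carrier → Carrier → Carrier → Exponent 3 → Carrier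
    m x y z = monomial (x ∷ y ∷ z ∷ [])
    w : Carrier → Carrier → Carrier → Carrier
    w x y z = x ^ b₁ * (y ^ b₂ * z ^ b₃)

    m·w : ∀ e₁ e₂ e₃ x y z →
      m x y z (e₁ ∷ e₂ ∷ e₃ ∷ []) * w x y z ≈ x ^ (e₁ ℕ.+ b₁) * (y ^ (e₂ ℕ.+ b₂) * z ^ (e₃ ℕ.+ b₃))
    m·w e₁ e₂ e₃ x y z = trans
      (solve 6 (λ x₁ x₂ y₁ y₂ z₁ z₂ → (x₁ :* (y₁ :* (z₁ :* con 1))) :* (x₂ :* (y₂ :* z₂)) := (x₁ :* x₂) :* ((y₁ :* y₂) :* (z₁ :* z₂)))
             refl (x ^ e₁) (x ^ b₁) (y ^ e₂) (y ^ b₂) (z ^ e₃) (z ^ b₃))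
      (sym (*-cong (^-homo-* x e₁ b₁) (*-cong (^-homo-* y e₂ b₂) (^-homo-* z e₃ b₃))))

    momentum : ∀ e₁ e₂ e₃ → ∑ (λ x → ∑ λ y → ∑ λ z → m x y z (e₁ ∷ e₂ ∷ e₃ ∷ []) * w x y z) ≈
                            powerSum (e₁ ℕ.+ b₁) * (powerSum (e₂ ℕ.+ b₂) * powerSum (e₃ ℕ.+ b₃))
    momentum e₁ e₂ e₃ = trans (∑-cong λ x → ∑-cong λ y → ∑-cong λ z → m·w e₁ e₂ e₃ x y z)
      (∑-product (_^ (e₁ ℕ.+ b₁)) (_^ (e₂ ℕ.+ b₂)) (_^ (e₃ ℕ.+ b₃)))

    diagonal : ∀ {m} → m ≡ suc n → - 1# ≈ powerSum m
    diagonal eq = sym (trans (reflexive (≡.cong powerSum eq)) powerSum-[q-1])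

    matching : ∀ e → All (_< 2 ℕ.+ n) e → indicator a κ e ≈ ∑ (λ x → ∑ λ y → ∑ λ z → m x y z e * w x y z)
    matching (e₁ ∷ e₂ ∷ e₃ ∷ []) (e₁< ∷ e₂< ∷ e₃< ∷ []) = trans by-cases (sym (momentum e₁ e₂ e₃))
      where
      e = e₁ ∷ e₂ ∷ e₃ ∷ []
      by-cases : indicator a κ e ≈ powerSum (e₁ ℕ.+ b₁) * (powerSum (e₂ ℕ.+ b₂) * powerSum (e₃ ℕ.+ b₃))
      by-cases with e₁ ℕ.≟ a₁ | e₂ ℕ.≟ a₂ | e₃ ℕ.≟ a₃
      ... | no e₁≢ | _ | _ = trans (indicator-≢ {e = a} {e} κ (e₁≢ ∘ ≡.cong Vec.head))
        (sym (trans (*-congʳ (powerSum-off-diagonal eq₁ 0<a₁ e₁< e₁≢)) (zeroˡ _)))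
      ... | yes _ | no e₂≢ | _ = trans (indicator-≢ {e = a} {e} κ (e₂≢ ∘ ≡.cong (Vec.head ∘ Vec.tail)))
        (sym (trans (*-congˡ (trans (*-congʳ (powerSum-off-diagonal eq₂ 0<a₂ e₂< e₂≢)) (zeroˡ _))) (zeroʳ _)))
      ... | yes _ | yes _ | no e₃≢ = trans (indicator-≢ {e = a} {e} κ (e₃≢ ∘ ≡.cong (Vec.head ∘ Vec.tail ∘ Vec.tail)))
        (sym (trans (*-congˡ (trans (*-congˡ (powerSum-off-diagonal eq₃ 0<a₃ e₃< e₃≢)) (zeroʳ _))) (zeroʳ _)))
      ... | yes ≡.refl | yes ≡.refl | yes ≡.refl = trans (indicator-refl a κ)
        (*-cong (diagonal eq₁) (*-cong (diagonal eq₂) (diagonal eq₃)))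

    orthogonality : ∀ e → coeff g e * indicator a κ e ≈ coeff g e * ∑ (λ x → ∑ λ y → ∑ λ z → m x y z e * w x y z)
    -- The two weights may differ at unreduced exponents, but there `g` has coefficient zero.
    orthogonality e with coeff g e ≟ 0#
    ... | yes ≈0 = trans (trans (*-congʳ ≈0) (zeroˡ _)) (sym (trans (*-congʳ ≈0) (zeroˡ _)))
    ... | no  ≉0 = *-congˡ (matching e (reduced e ≉0))

  moment-x-vanishes : ∀ {F} → (∀ y z → ∑ (λ x → F x y z) ≈ 0#) → ∀ b₂ b₃ → moment F 0 b₂ b₃ ≈ 0#
  moment-x-vanishes {F} vanish b₂ b₃ = begin
    moment F 0 b₂ b₃                                             ≈⟨ ∑-swap _ ⟩
    ∑ (λ y → ∑ λ x → ∑ λ z → F x y z * (1# * (y ^ b₂ * z ^ b₃))) ≈⟨ ∑-cong (λ y → ∑-swap _) ⟩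
    ∑ (λ y → ∑ λ z → ∑ λ x → F x y z * (1# * (y ^ b₂ * z ^ b₃))) ≈⟨ ∑-zero (λ y → ∑-zero λ z → trans (∑-* _ _) (trans (*-congʳ (vanish y z)) (zeroˡ _))) ⟩
    0#                                                           ∎

  moment-y-vanishes : ∀ {F} → (∀ x z → ∑ (λ y → F x y z) ≈ 0#) → ∀ b₁ b₃ → moment F b₁ 0 b₃ ≈ 0#
  moment-y-vanishes {F} vanish b₁ b₃ = begin
    moment F b₁ 0 b₃                                             ≈⟨ ∑-cong (λ x → ∑-swap _) ⟩
    ∑ (λ x → ∑ λ z → ∑ λ y → F x y z * (x ^ b₁ * (1# * z ^ b₃))) ≈⟨ ∑-zero (λ x → ∑-zero λ z → trans (∑-* _ _) (trans (*-congʳ (vanish x z)) (zeroˡ _))) ⟩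
    0#                                                           ∎

  moment-z-vanishes : ∀ {F} → (∀ x y → ∑ (λ z → F x y z) ≈ 0#) → ∀ b₁ b₂ → moment F b₁ b₂ 0 ≈ 0#
  moment-z-vanishes vanish b₁ b₂ = ∑-zero λ x → ∑-zero λ y →
    trans (∑-* _ _) (trans (*-congʳ (vanish x y)) (zeroˡ _))

-- Fields with q = 9 + k = 3^(r+1) elements

module CharacteristicThree {c ℓ} (R : CommutativeRing c ℓ)
  (k : ℕ) (enumeration : Inverse (CommutativeRing.setoid R) (≡.setoid (Fin (9 ℕ.+ k))))
  (invertible : NonzeroInvertible R)
  (r : ℕ) (q≡3^ : 9 ℕ.+ k ≡ 3 ℕ.^ suc r) where

  open CommutativeRing R hiding (zero)
  open FormalSums R using (tAt; tAt-cong; eval; reduced-representative)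
  open FiniteField R (7 ℕ.+ k) enumeration invertible
  open import Algebra.Properties.Ring ring
    using (x∙y⁻¹≈ε⇒x≈y; x≈y⇒x∙y⁻¹≈ε; [y-z]x≈yx-zx; -0#≈0#; +-cancelʳ; +-inverseʳ-unique; -1*x≈-x)
  open import Algebra.Properties.CommutativeSemiring.Exp commutativeSemiring
  open import Algebra.Properties.Semiring.Mult.TCOptimised semiring
    using (×ᵤ≈×; ×-homo-+; ×1-homo-*) renaming (_×_ to _·_)
  open import Algebra.Properties.Semiring.Sum semiring using (sum; sum-cong-≋; *-distribˡ-sum)
  open import Relation.Binary.Reasoning.Setoid setoid

  1+1+1≈0 : 3 · 1# ≈ 0#
  1+1+1≈0 = trans (sym (×ᵤ≈× 3 1#)) (characteristic 3 (suc r) (≡.sym q≡3^))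

  -- A ring solver with coefficients in ℤ/3, represented by the remainders 0, 1 and 2.
  private
    ·-%3 : ∀ m → (m % 3) · 1# ≈ m · 1#
    ·-%3 m = sym (begin
      m · 1#                             ≡⟨ ≡.cong (_· 1#) (m≡m%n+[m/n]*n m 3) ⟩
      (m % 3 ℕ.+ m / 3 ℕ.* 3) · 1#       ≈⟨ ×-homo-+ 1# (m % 3) (m / 3 ℕ.* 3) ⟩
      (m % 3) · 1# + (m / 3 ℕ.* 3) · 1#  ≈⟨ +-congˡ (trans (×1-homo-* (m / 3) 3) (trans (*-congˡ 1+1+1≈0) (zeroʳ _))) ⟩
      (m % 3) · 1# + 0#                  ≈⟨ +-identityʳ _ ⟩
      (m % 3) · 1#                       ∎)

    2≈-1 : 2 · 1# ≈ - 1#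
    2≈-1 = +-inverseʳ-unique 1# (1# + 1#) (trans (sym (+-assoc 1# 1# 1#)) 1+1+1≈0)

    ℤ/3 : RawRing _ _
    ℤ/3 = record
      { Carrier = ℕ
      ; _≈_     = _≡_
      ; _+_     = λ l m → (l ℕ.+ m) % 3
      ; _*_     = λ l m → (l ℕ.* m) % 3
      ; -_      = λ m → (2 ℕ.* m) % 3
      ; 0#      = 0
      ; 1#      = 1
      }

    embedding : ℤ/3 -Raw-AlmostCommutative⟶ fromCommutativeRing R
    embedding = record
      { ⟦_⟧    = _· 1#
      ; +-homo = λ l m → trans (·-%3 (l ℕ.+ m)) (×-homo-+ 1# l m)
      ; *-homo = λ l m → trans (·-%3 (l ℕ.* m)) (×1-homo-* l m)
      ; -‿homo = λ m → trans (·-%3 (2 ℕ.* m)) (trans (×1-homo-* 2 m) (trans (*-congʳ 2≈-1) (-1*x≈-x _)))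
      ; 0-homo = refl
      ; 1-homo = refl
      }

    coefficient-≟ : ∀ l m → Maybe (l · 1# ≈ m · 1#)
    coefficient-≟ l m = Maybe.map (reflexive ∘ ≡.cong (_· 1#)) (dec⇒weaklyDec ℕ._≟_ l m)

  open RingSolver ℤ/3 (fromCommutativeRing R) embedding coefficient-≟
    using (solve; _:+_; _:*_; _:^_; _:-_; :-_; _:=_; con)

  -- Inversion with 1/0 = 0, and sums of fractions

  inv : Carrier → Carrier
  inv x = x ^ (7 ℕ.+ k)

  inv-cong : Congruent _≈_ _≈_ inv
  inv-cong = ^-congˡ (7 ℕ.+ k)

  inv-* : ∀ x y → inv (x * y) ≈ inv x * inv y
  inv-* x y = ^-distrib-* x y (7 ℕ.+ k)

  inv-0 : ∀ {x} → x ≈ 0# → inv x ≈ 0#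
  inv-0 x≈0 = trans (*-congʳ x≈0) (zeroˡ _)

  inv-inverse : ∀ {x} → ¬ x ≈ 0# → x * inv x ≈ 1#
  inv-inverse = x^[q-1]≈1

  inv-unique : ∀ {x y} → x * y ≈ 1# → inv x ≈ y
  inv-unique {x} {y} xy≈1 = *-cancelˡ x≉0 (trans (inv-inverse x≉0) (sym xy≈1))
    where
    x≉0 : ¬ x ≈ 0#
    x≉0 x≈0 = 1≉0 (trans (sym xy≈1) (trans (*-congʳ x≈0) (zeroˡ y)))

  inv-1 : ∀ {x} → x ≈ 1# → inv x ≈ 1#
  inv-1 x≈1 = inv-unique (trans (*-congʳ x≈1) (*-identityʳ 1#))

  inv-neg : ∀ x → inv (- x) ≈ - inv x
  inv-neg x with x ≟ 0#
  ... | yes x≈0 = trans (inv-0 (trans (-‿cong x≈0) -0#≈0#)) (sym (trans (-‿cong (inv-0 x≈0)) -0#≈0#))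
  ... | no  x≉0 = inv-unique (trans
    (solve 2 (λ x y → (:- x) :* (:- y) := x :* y) refl x (inv x)) (inv-inverse x≉0))

  inv-involutive : ∀ x → inv (inv x) ≈ x
  inv-involutive x with x ≟ 0#
  ... | yes x≈0 = trans (inv-0 (inv-0 x≈0)) (sym x≈0)
  ... | no  x≉0 = inv-unique (trans (*-comm _ x) (inv-inverse x≉0))

  -- The form of cancellation that survives at 0, where `x * inv x` is 0 instead of 1.
  x²·inv≈x : ∀ x → x * (x * inv x) ≈ x
  x²·inv≈x x with x ≟ 0#
  ... | yes x≈0 = trans (*-congʳ x≈0) (trans (zeroˡ _) (sym x≈0))
  ... | no  x≉0 = trans (*-congˡ (inv-inverse x≉0)) (*-identityʳ x)

  -- For nonzero `x` both sides become 1 on multiplication by `x^3`; at 0 both vanish, the left one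
  -- because `q - 4` is positive.
  x^[q-4]≈inv³ : ∀ x → x ^ (5 ℕ.+ k) ≈ inv x ^ 3
  x^[q-4]≈inv³ x with x ≟ 0#
  ... | yes x≈0 = trans (trans (*-congʳ x≈0) (zeroˡ _)) (sym (trans (*-congʳ (inv-0 x≈0)) (zeroˡ _)))
  ... | no  x≉0 = *-cancelˡ x≉0 (*-cancelˡ x≉0 (*-cancelˡ x≉0 (begin
    x * (x * (x * x ^ (5 ℕ.+ k))) ≈⟨ inv-inverse x≉0 ⟩
    1#                            ≈⟨ solve 0 (con 1 :^ 3 := con 1) refl ⟨
    1# ^ 3                        ≈⟨ ^-congˡ 3 (inv-inverse x≉0) ⟨
    (x * inv x) ^ 3               ≈⟨ solve 2 (λ x y → (x :* y) :^ 3 := x :* (x :* (x :* y :^ 3))) refl x (inv x) ⟩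
    x * (x * (x * inv x ^ 3))     ∎)))

  inversion : Inverse setoid setoid
  inversion = permutation inv inv inv-cong inv-cong inv-involutive inv-involutive

  -- The inverse is the power `3^r`, as the composite raises to the power `3^(r+1) = q`.
  cubing : Inverse setoid setoid
  cubing = permutation (_^ 3) (_^ (3 ℕ.^ r)) (^-congˡ 3) (^-congˡ (3 ℕ.^ r))
    (λ x → trans (^-assocʳ x (3 ℕ.^ r) 3) (x^3^≈x x (ℕ.*-comm (3 ℕ.^ r) 3)))
    (λ x → trans (^-assocʳ x 3 (3 ℕ.^ r)) (x^3^≈x x ≡.refl))
    where
    x^3^≈x : ∀ x {m} → m ≡ 3 ℕ.* 3 ℕ.^ r → x ^ m ≈ x
    x^3^≈x x eq = trans (reflexive (≡.cong (x ^_) (≡.trans eq (≡.sym q≡3^)))) (x^q≈x x)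

  powerSum≈0 : ∀ m {m≤7 : True (m ℕ.≤? 7)} → powerSum m ≈ 0#
  powerSum≈0 m {m≤7} = powerSum-small m (s≤s (ℕ.≤-trans (toWitness m≤7) (ℕ.m≤m+n 7 k)))

  ∑-id : ∑ (λ x → x) ≈ 0#
  ∑-id = trans (∑-cong (λ x → sym (*-identityʳ x))) (powerSum≈0 1)

  ∑-permutation : (π : Inverse setoid setoid) → ∑ (Inverse.to π) ≈ 0#
  ∑-permutation π = trans (∑-permute π (λ eq → eq)) ∑-id

  ∑-inv : ∑ inv ≈ 0#
  ∑-inv = ∑-permutation inversion

  ∑-x·inv : ∑ (λ x → x * inv x) ≈ - 1#
  ∑-x·inv = powerSum-[q-1]

  ∑-substitute-inv : ∀ {f} → Congruent _≈_ _≈_ f → ∑ (λ x → x * f (inv x)) ≈ ∑ (λ x → inv x * f x)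
  ∑-substitute-inv {f} f-cong = trans
    (∑-cong λ x → *-congʳ (sym (inv-involutive x)))
    (∑-permute inversion λ eq → *-cong (inv-cong eq) (f-cong eq))

  ∑-+≈ : ∀ {f g a b} → ∑ f ≈ a → ∑ g ≈ b → ∑ (λ x → f x + g x) ≈ a + b
  ∑-+≈ {f} {g} f≈a g≈b = trans (∑-+ f g) (+-cong f≈a g≈b)

  ∑-*≈ : ∀ {f a} u → ∑ f ≈ a → ∑ (λ x → u * f x) ≈ u * a
  ∑-*≈ {f} u f≈a = trans (sym (*-∑ u f)) (*-congˡ f≈a)

  ∑-neg : ∀ {f a} → ∑ f ≈ a → ∑ (λ x → - f x) ≈ - a
  ∑-neg f≈a = trans (∑-cong λ x → sym (-1*x≈-x _)) (trans (∑-*≈ (- 1#) f≈a) (-1*x≈-x _))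

  -- At `x = 0` the outer factor kills both sides. For other `x` the pole is the same on both sides,
  -- since `u + 1/x` is `u x + 1` divided by `x`.
  x·inv[u+inv] : ∀ u x → x * inv (u + inv x) ≈ x * x * inv (u * x + 1#)
  x·inv[u+inv] u x with x ≟ 0#
  ... | yes x≈0 = trans (trans (*-congʳ x≈0) (zeroˡ _))
                        (sym (trans (*-congʳ (trans (*-congʳ x≈0) (zeroˡ x))) (zeroˡ _)))
  ... | no  x≉0 = trans (*-congˡ (begin
    inv (u + inv x)                ≈⟨ inv-cong (+-congʳ (trans (sym (*-identityʳ u)) (*-congˡ (sym (inv-inverse x≉0))))) ⟩
    inv (u * (x * inv x) + inv x)  ≈⟨ inv-cong (solve 3 (λ u x i → u :* (x :* i) :+ i := i :* (u :* x :+ con 1)) refl u x (inv x)) ⟩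
    inv (inv x * (u * x + 1#))     ≈⟨ inv-* (inv x) _ ⟩
    inv (inv x) * inv (u * x + 1#) ≈⟨ *-congʳ (inv-involutive x) ⟩
    x * inv (u * x + 1#)           ∎)) (sym (*-assoc x x _))

  -- After `x ↦ 1/x` the summand is `x^2/(u x + 1)`. For nonzero `u`, the variable `w = u x + 1`
  -- makes it `(w - 1)^2/w` divided by `u^2`. In characteristic 3 this numerator is `w^2 + w + 1`,
  -- and only its middle term, giving `w * inv w`, has a nonzero sum. For `u = 0` a sum of squares
  -- remains, which vanishes.
  ∑-inv·inv[u+x] : ∀ u → ∑ (λ x → inv x * inv (u + x)) ≈ - (inv u ^ 2)
  ∑-inv·inv[u+x] u = begin
    ∑ (λ x → inv x * inv (u + x))         ≈⟨ ∑-substitute-inv (inv-cong ∘ +-congˡ) ⟨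
    ∑ (λ x → x * inv (u + inv x))         ≈⟨ ∑-cong (x·inv[u+inv] u) ⟩
    ∑ (λ x → x * x * inv (u * x + 1#))    ≈⟨ by-cases ⟩
    - (inv u ^ 2)                         ∎
    where
    ∑-[x-1]²·inv : ∑ (λ x → (x - 1#) ^ 2 * inv x) ≈ - 1#
    ∑-[x-1]²·inv = begin
      ∑ (λ x → (x - 1#) ^ 2 * inv x)                 ≈⟨ ∑-cong (λ x → solve 2 (λ x i →
                                                          (x :- con 1) :^ 2 :* i := (x :* (x :* i) :+ x :* i) :+ i) refl x (inv x)) ⟩
      ∑ (λ x → (x * (x * inv x) + x * inv x) + inv x) ≈⟨ ∑-+≈ (∑-+≈ (trans (∑-cong x²·inv≈x) ∑-id) ∑-x·inv) ∑-inv ⟩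
      (0# + - 1#) + 0#                               ≈⟨ trans (+-identityʳ _) (+-identityˡ _) ⟩
      - 1#                                           ∎

    h : Carrier → Carrier
    h x = (x - 1#) ^ 2 * inv x

    h-cong : Congruent _≈_ _≈_ h
    h-cong eq = *-cong (^-congˡ 2 (+-congʳ eq)) (inv-cong eq)

    by-cases : ∑ (λ x → x * x * inv (u * x + 1#)) ≈ - (inv u ^ 2)
    by-cases with u ≟ 0#
    ... | yes u≈0 = begin
      ∑ (λ x → x * x * inv (u * x + 1#)) ≈⟨ ∑-cong (λ x → *-congˡ (inv-1 (trans (+-congʳ (trans (*-congʳ u≈0) (zeroˡ x))) (+-identityˡ 1#)))) ⟩
      ∑ (λ x → x * x * 1#)               ≈⟨ ∑-cong (λ x → *-assoc x x 1#) ⟩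
      powerSum 2                         ≈⟨ powerSum≈0 2 ⟩
      0#                                 ≈⟨ solve 0 (con 0 := :- (con 0 :^ 2)) refl ⟩
      - (0# ^ 2)                         ≈⟨ -‿cong (^-congˡ 2 (inv-0 u≈0)) ⟨
      - (inv u ^ 2)                      ∎
    ... | no  u≉0 = begin
      ∑ (λ x → x * x * inv (u * x + 1#))                    ≈⟨ ∑-cong rescale ⟩
      ∑ (λ x → inv u ^ 2 * h (u * x + 1#))                  ≈⟨ *-∑ (inv u ^ 2) (λ x → h (u * x + 1#)) ⟨
      inv u ^ 2 * ∑ (λ x → h (u * x + 1#))                  ≈⟨ *-congˡ (∑-scale (h-cong ∘ +-congʳ) u≉0) ⟩
      inv u ^ 2 * ∑ (λ x → h (x + 1#))                      ≈⟨ *-congˡ (∑-translate h-cong 1#) ⟩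
      inv u ^ 2 * ∑ h                                       ≈⟨ *-congˡ ∑-[x-1]²·inv ⟩
      inv u ^ 2 * - 1#                                      ≈⟨ solve 1 (λ i → i :^ 2 :* (:- con 1) := :- (i :^ 2)) refl (inv u) ⟩
      - (inv u ^ 2)                                         ∎
      where
      rescale : ∀ x → x * x * inv (u * x + 1#) ≈ inv u ^ 2 * h (u * x + 1#)
      rescale x = begin
        x * x * w                                ≈⟨ *-congʳ (*-cong unit·x unit·x) ⟨
        (u * inv u * x) * (u * inv u * x) * w    ≈⟨ solve 4 (λ u i x w → (u :* i :* x) :* (u :* i :* x) :* w :=
                                                     i :^ 2 :* ((u :* x :+ con 1 :- con 1) :^ 2 :* w)) refl u (inv u) x w ⟩
        inv u ^ 2 * h (u * x + 1#)               ∎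
        where
        w = inv (u * x + 1#)
        unit·x : u * inv u * x ≈ x
        unit·x = trans (*-congʳ (inv-inverse u≉0)) (*-identityˡ x)

  -- A shift by 1, the substitution `x ↦ 1/x` and another shift turn the summand into `(x - 1)^7/x`.
  -- In characteristic 3 `(x - 1)^7` is `(x^6 + x^3 + 1)(x - 1)`; over `x`, only its linear term has
  -- a nonzero sum, that of `x * inv x`.
  ∑-inv·inv[x-1]⁶ : ∑ (λ x → inv x * inv (x - 1#) ^ 6) ≈ - 1#
  ∑-inv·inv[x-1]⁶ = begin
    ∑ (λ x → inv x * inv (x - 1#) ^ 6)
      ≈⟨ ∑-translate (λ eq → *-cong (inv-cong eq) (^-congˡ 6 (inv-cong (+-congʳ eq)))) 1# ⟨
    ∑ (λ x → inv (x + 1#) * inv (x + 1# - 1#) ^ 6)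
      ≈⟨ ∑-cong (λ x → trans
           (*-cong (inv-cong (+-comm x 1#)) (^-congˡ 6 (inv-cong (solve 1 (λ x → x :+ con 1 :- con 1 := x) refl x))))
           (solve 2 (λ i j → i :* j :^ 6 := j :* (j :^ 5 :* i)) refl (inv (1# + x)) (inv x))) ⟩
    ∑ (λ x → inv x * (inv x ^ 5 * inv (1# + x)))
      ≈⟨ ∑-substitute-inv (λ eq → *-cong (^-congˡ 5 (inv-cong eq)) (inv-cong (+-congˡ eq))) ⟨
    ∑ (λ x → x * (inv (inv x) ^ 5 * inv (1# + inv x)))
      ≈⟨ ∑-cong pointwise ⟩
    ∑ (λ x → h (x + 1#))
      ≈⟨ ∑-translate h-cong 1# ⟩
    ∑ h
      ≈⟨ ∑-cong expand ⟩
    ∑ (λ x → ((((x ^ 6 - x ^ 5) + x ^ 3) - x ^ 2) + x * inv x) - inv x)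
      ≈⟨ ∑-+≈ (∑-+≈ (∑-+≈ (∑-+≈ (∑-+≈ (powerSum≈0 6) (∑-neg (powerSum≈0 5))) (powerSum≈0 3)) (∑-neg (powerSum≈0 2))) ∑-x·inv) (∑-neg ∑-inv) ⟩
    ((((0# - 0#) + 0#) - 0#) + - 1#) - 0#
      ≈⟨ solve 0 (((((con 0 :- con 0) :+ con 0) :- con 0) :+ (:- con 1)) :- con 0 := :- con 1) refl ⟩
    - 1# ∎
    where
    h : Carrier → Carrier
    h x = (x - 1#) ^ 7 * inv x

    h-cong : Congruent _≈_ _≈_ h
    h-cong eq = *-cong (^-congˡ 7 (+-congʳ eq)) (inv-cong eq)

    pointwise : ∀ x → x * (inv (inv x) ^ 5 * inv (1# + inv x)) ≈ h (x + 1#)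
    pointwise x = begin
      x * (inv (inv x) ^ 5 * inv (1# + inv x))  ≈⟨ *-congˡ (*-congʳ (^-congˡ 5 (inv-involutive x))) ⟩
      x * (x ^ 5 * w)                           ≈⟨ solve 2 (λ x w → x :* (x :^ 5 :* w) := x :^ 5 :* (x :* w)) refl x w ⟩
      x ^ 5 * (x * w)                           ≈⟨ *-congˡ (x·inv[u+inv] 1# x) ⟩
      x ^ 5 * (x * x * inv (1# * x + 1#))       ≈⟨ *-congˡ (*-congˡ (inv-cong (+-congʳ (*-identityˡ x)))) ⟩
      x ^ 5 * (x * x * inv (x + 1#))            ≈⟨ solve 2 (λ x w → x :^ 5 :* (x :* x :* w) := (x :+ con 1 :- con 1) :^ 7 :* w) refl x (inv (x + 1#)) ⟩
      h (x + 1#)                                ∎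
      where w = inv (1# + inv x)

    expand : ∀ x → h x ≈ ((((x ^ 6 - x ^ 5) + x ^ 3) - x ^ 2) + x * inv x) - inv x
    expand x = begin
      h x
        ≈⟨ solve 2 (λ x i → (x :- con 1) :^ 7 :* i :=
             (((x :^ 5 :- x :^ 4) :+ x :^ 2) :- x) :* (x :* (x :* i)) :+ x :* i :- i) refl x (inv x) ⟩
      (((x ^ 5 - x ^ 4) + x ^ 2) - x) * (x * (x * inv x)) + x * inv x - inv x
        ≈⟨ +-congʳ (+-congʳ (*-congˡ (x²·inv≈x x))) ⟩
      (((x ^ 5 - x ^ 4) + x ^ 2) - x) * x + x * inv x - inv x
        ≈⟨ solve 2 (λ x i → (((x :^ 5 :- x :^ 4) :+ x :^ 2) :- x) :* x :+ x :* i :- i :=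
             ((((x :^ 6 :- x :^ 5) :+ x :^ 3) :- x :^ 2) :+ x :* i) :- i) refl x (inv x) ⟩
      ((((x ^ 6 - x ^ 5) + x ^ 3) - x ^ 2) + x * inv x) - inv x ∎

  -- The transposition t as a function on the field

  τ : Carrier → Carrier
  τ = tAt (9 ℕ.+ k)

  τ-cong : Congruent _≈_ _≈_ τ
  τ-cong = tAt-cong (9 ℕ.+ k)

  geometric-sum : ∀ m y → 1# + y * sum {m} (λ i → y ^ toℕ i) ≈ sum {m} (λ i → y ^ toℕ i) + y ^ m
  geometric-sum zero    y = solve 1 (λ y → con 1 :+ y :* con 0 := con 0 :+ con 1) refl y
  geometric-sum (suc m) y = begin
    1# + y * sum {suc m} (λ i → y ^ toℕ i)    ≈⟨ +-congˡ (*-congˡ (trans step (geometric-sum m y))) ⟩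
    1# + y * (G + y ^ m)                      ≈⟨ solve 3 (λ y G p → con 1 :+ y :* (G :+ p) := (con 1 :+ y :* G) :+ y :* p) refl y G (y ^ m) ⟩
    (1# + y * G) + y ^ suc m                  ≈⟨ +-congʳ step ⟨
    sum {suc m} (λ i → y ^ toℕ i) + y ^ suc m ∎
    where
    G = sum {m} (λ i → y ^ toℕ i)
    step : sum {suc m} (λ i → y ^ toℕ i) ≈ 1# + y * G
    step = +-congˡ (sym (*-distribˡ-sum {m} y (λ i → y ^ toℕ i)))

  τ-0 : ∀ {y} → y ≈ 0# → τ y ≈ 1#
  τ-0 {y} y≈0 = begin
    y + (1# + sum {7 ℕ.+ k} (λ i → y ^ suc (toℕ i)))
      ≈⟨ +-cong y≈0 (+-congˡ (FiniteSums.sum-ε +-commutativeMonoid {7 ℕ.+ k} (λ i → y ^ suc (toℕ i))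
                               λ i → trans (*-congʳ y≈0) (zeroˡ (y ^ toℕ i)))) ⟩
    0# + (1# + 0#)
      ≈⟨ solve 0 (con 0 :+ (con 1 :+ con 0) := con 1) refl ⟩
    1# ∎

  τ-1 : ∀ {y} → y ≈ 1# → τ y ≈ 0#
  τ-1 {y} y≈1 = begin
    y + sum {8 ℕ.+ k} (λ i → y ^ toℕ i)  ≈⟨ +-cong y≈1 (sum-cong-≋ {n = 8 ℕ.+ k} λ i → y^≈1 (toℕ i)) ⟩
    -- The summand `y` and the `q - 1` powers of `y` together make `q` ones.
    sum {9 ℕ.+ k} (λ _ → 1#)             ≈⟨ trans (sym (∑≈sum _)) (∑-const 1#) ⟩
    0#                                   ∎
    where
    y^≈1 : ∀ i → y ^ i ≈ 1#
    y^≈1 zero    = refl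
    y^≈1 (suc i) = trans (*-cong y≈1 (y^≈1 i)) (*-identityʳ 1#)

  -- The geometric sum `G` satisfies `(y - 1) G = y^(q-1) - 1 = 0`, and `y - 1` is nonzero.
  τ-fixed : ∀ {y} → ¬ y ≈ 0# → ¬ y ≈ 1# → τ y ≈ y
  τ-fixed {y} y≉0 y≉1 = trans (+-congˡ G≈0) (+-identityʳ y)
    where
    G = sum {8 ℕ.+ k} (λ i → y ^ toℕ i)
    y*G≈G : y * G ≈ 1# * G
    y*G≈G = +-cancelʳ 1# _ _ (begin
      y * G + 1#            ≈⟨ +-comm _ 1# ⟩
      1# + y * G            ≈⟨ geometric-sum (8 ℕ.+ k) y ⟩
      G + y ^ (8 ℕ.+ k)     ≈⟨ +-cong (sym (*-identityˡ G)) (x^[q-1]≈1 y≉0) ⟩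
      1# * G + 1#           ∎)
    G≈0 : G ≈ 0#
    G≈0 = no-zero-divisors (y≉1 ∘ x∙y⁻¹≈ε⇒x≈y y 1#) (trans ([y-z]x≈yx-zx G y 1#) (x≈y⇒x∙y⁻¹≈ε y*G≈G))

  ≈1⇒≉0 : ∀ {y} → y ≈ 1# → ¬ y ≈ 0#
  ≈1⇒≉0 y≈1 y≈0 = 1≉0 (trans (sym y≈1) y≈0)

  data Trichotomy (y : Carrier) : Set ℓ where
    is-0  : y ≈ 0# → Trichotomy y
    is-1  : y ≈ 1# → Trichotomy y
    other : ¬ y ≈ 0# → ¬ y ≈ 1# → Trichotomy y

  trichotomy : ∀ y → Trichotomy y
  trichotomy y with y ≟ 0# | y ≟ 1#
  ... | yes y≈0 | _       = is-0 y≈0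
  ... | no  _   | yes y≈1 = is-1 y≈1
  ... | no  y≉0 | no  y≉1 = other y≉0 y≉1

  τ-involutive : ∀ y → τ (τ y) ≈ y
  τ-involutive y with trichotomy y
  ... | is-0 y≈0      = trans (τ-1 (τ-0 y≈0)) (sym y≈0)
  ... | is-1 y≈1      = trans (τ-0 (τ-1 y≈1)) (sym y≈1)
  ... | other y≉0 y≉1 = trans (τ-cong (τ-fixed y≉0 y≉1)) (τ-fixed y≉0 y≉1)

  transposition : Inverse setoid setoid
  transposition = permutation τ τ τ-cong τ-cong τ-involutive τ-involutive

  -- Pointwise `τ x + [x = 1] = x + [x = 0]`; after multiplication by `f x`, each indicator picks
  -- out one value of `f`.
  ∑-τ· : ∀ {f} → Congruent _≈_ _≈_ f → ∑ (λ x → τ x * f x) + f 1# ≈ ∑ (λ x → x * f x) + f 0#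
  ∑-τ· {f} f-cong = begin
    ∑ (λ x → τ x * f x) + f 1#                  ≈⟨ +-congˡ (∑-at 1#) ⟨
    ∑ (λ x → τ x * f x) + ∑ (at 1# (f 1#) 0#)   ≈⟨ ∑-+ (λ x → τ x * f x) (at 1# (f 1#) 0#) ⟨
    ∑ (λ x → τ x * f x + at 1# (f 1#) 0# x)     ≈⟨ ∑-cong pointwise ⟩
    ∑ (λ x → x * f x + at 0# (f 0#) 0# x)       ≈⟨ ∑-+ (λ x → x * f x) (at 0# (f 0#) 0#) ⟩
    ∑ (λ x → x * f x) + ∑ (at 0# (f 0#) 0#)     ≈⟨ +-congˡ (∑-at 0#) ⟩
    ∑ (λ x → x * f x) + f 0#                    ∎
    where
    ∑-at : ∀ a → ∑ (at a (f a) 0#) ≈ f a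
    ∑-at a = trans (∑-single (at-cong a (f a) 0#) a λ x → at-≉ (f a) 0#) (at-≈ (f a) 0# refl)

    pointwise : ∀ x → τ x * f x + at 1# (f 1#) 0# x ≈ x * f x + at 0# (f 0#) 0# x
    pointwise x with trichotomy x
    ... | is-0 x≈0 = begin
      τ x * f x + at 1# (f 1#) 0# x ≈⟨ +-cong (*-cong (τ-0 x≈0) (f-cong x≈0)) (at-≉ _ 0# λ x≈1 → ≈1⇒≉0 x≈1 x≈0) ⟩
      1# * f 0# + 0#                ≈⟨ solve 1 (λ a → con 1 :* a :+ con 0 := con 0 :* a :+ a) refl (f 0#) ⟩
      0# * f 0# + f 0#              ≈⟨ +-cong (*-cong x≈0 (f-cong x≈0)) (at-≈ _ 0# x≈0) ⟨
      x * f x + at 0# (f 0#) 0# x   ∎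
    ... | is-1 x≈1 = begin
      τ x * f x + at 1# (f 1#) 0# x ≈⟨ +-cong (*-cong (τ-1 x≈1) (f-cong x≈1)) (at-≈ _ 0# x≈1) ⟩
      0# * f 1# + f 1#              ≈⟨ solve 1 (λ a → con 0 :* a :+ a := con 1 :* a :+ con 0) refl (f 1#) ⟩
      1# * f 1# + 0#                ≈⟨ +-cong (*-cong x≈1 (f-cong x≈1)) (at-≉ _ 0# (≈1⇒≉0 x≈1)) ⟨
      x * f x + at 0# (f 0#) 0# x   ∎
    ... | other x≉0 x≉1 = +-cong (*-congʳ (τ-fixed x≉0 x≉1)) (trans (at-≉ _ 0# x≉1) (sym (at-≉ _ 0# x≉0)))

  -- The shift `z ↦ z - y` puts the bare variable under `τ`, where removing `τ` costs only two
  -- values of `1/(z - y)`. What remains is the sum of `z/(z - y)`, which splits into those of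
  -- `z * inv z` and `y * inv z`.
  ∑-inv·τ[y+z] : ∀ y → ∑ (λ z → inv z * τ (y + z)) + inv (1# - y) ≈ inv (0# - y) - 1#
  ∑-inv·τ[y+z] y = begin
    ∑ (λ z → inv z * τ (y + z)) + inv (1# - y)  ≈⟨ +-congʳ (trans (∑-cong rearrange) (∑-translate (λ eq → *-cong (τ-cong eq) (f-cong eq)) y)) ⟩
    ∑ (λ z → τ z * inv (z - y)) + inv (1# - y)  ≈⟨ ∑-τ· f-cong ⟩
    ∑ (λ z → z * inv (z - y)) + inv (0# - y)    ≈⟨ +-congʳ linear ⟩
    - 1# + inv (0# - y)                         ≈⟨ +-comm _ _ ⟩
    inv (0# - y) - 1#                           ∎
    where
    f-cong : Congruent _≈_ _≈_ (λ z → inv (z - y))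
    f-cong = inv-cong ∘ +-congʳ

    z+y-y≈z : ∀ z → z + y - y ≈ z
    z+y-y≈z z = solve 2 (λ z y → z :+ y :- y := z) refl z y

    rearrange : ∀ z → inv z * τ (y + z) ≈ τ (z + y) * inv (z + y - y)
    rearrange z = trans (*-comm _ _) (*-cong (τ-cong (+-comm y z)) (inv-cong (sym (z+y-y≈z z))))

    linear : ∑ (λ z → z * inv (z - y)) ≈ - 1#
    linear = begin
      ∑ (λ z → z * inv (z - y))              ≈⟨ ∑-translate (λ eq → *-cong eq (f-cong eq)) y ⟨
      ∑ (λ z → (z + y) * inv (z + y - y))    ≈⟨ ∑-cong (λ z → trans (*-congˡ (inv-cong (z+y-y≈z z))) (distribʳ (inv z) z y)) ⟩
      ∑ (λ z → z * inv z + y * inv z)        ≈⟨ ∑-+≈ ∑-x·inv (∑-*≈ y ∑-inv) ⟩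
      - 1# + y * 0#                          ≈⟨ trans (+-congˡ (zeroʳ y)) (+-identityʳ _) ⟩
      - 1#                                   ∎

  -- Swapping 0 and 1 leaves 1/(1 − s) − 1/(−s) unchanged when 1/0 is read as 0.
  inv-τ-difference : ∀ s → inv (0# - τ s) - inv (1# - τ s) ≈ inv (s - 1#) - inv s
  inv-τ-difference s with trichotomy s
  ... | is-0 s≈0 = begin
    inv (0# - τ s) - inv (1# - τ s) ≈⟨ +-cong inv[0-τs]≈-1 (-‿cong (inv-0 (trans (+-congˡ (-‿cong (τ-0 s≈0))) (-‿inverseʳ 1#)))) ⟩
    - 1# - 0#                       ≈⟨ +-cong inv[s-1]≈-1 (-‿cong (inv-0 s≈0)) ⟨
    inv (s - 1#) - inv s            ∎
    where
    inv[0-τs]≈-1 : inv (0# - τ s) ≈ - 1#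
    inv[0-τs]≈-1 = trans (inv-cong (+-identityˡ _)) (trans (inv-neg (τ s)) (-‿cong (inv-1 (τ-0 s≈0))))
    inv[s-1]≈-1 : inv (s - 1#) ≈ - 1#
    inv[s-1]≈-1 = trans (inv-cong (trans (+-congʳ s≈0) (+-identityˡ _))) (trans (inv-neg 1#) (-‿cong (inv-1 refl)))
  ... | is-1 s≈1 = begin
    inv (0# - τ s) - inv (1# - τ s) ≈⟨ +-cong (inv-0 (trans (+-congˡ (-‿cong τs≈0)) (-‿inverseʳ 0#))) (-‿cong (inv-1 (trans (+-congˡ (trans (-‿cong τs≈0) -0#≈0#)) (+-identityʳ 1#)))) ⟩
    0# - 1#                         ≈⟨ +-cong (inv-0 (trans (+-congʳ s≈1) (-‿inverseʳ 1#))) (-‿cong (inv-1 s≈1)) ⟨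
    inv (s - 1#) - inv s            ∎
    where
    τs≈0 : τ s ≈ 0#
    τs≈0 = τ-1 s≈1
  ... | other s≉0 s≉1 = begin
    inv (0# - τ s) - inv (1# - τ s)     ≈⟨ +-cong (inv-cong (+-congˡ (-‿cong τs≈s))) (-‿cong (inv-cong (+-congˡ (-‿cong τs≈s)))) ⟩
    inv (0# - s) - inv (1# - s)         ≈⟨ +-cong (inv-cong (+-identityˡ _)) (-‿cong (inv-cong (solve 1 (λ s → con 1 :- s := :- (s :- con 1)) refl s))) ⟩
    inv (- s) - inv (- (s - 1#))        ≈⟨ +-cong (inv-neg s) (-‿cong (inv-neg (s - 1#))) ⟩
    - inv s - - inv (s - 1#)            ≈⟨ solve 2 (λ a b → (:- a) :- (:- b) := b :- a) refl (inv s) (inv (s - 1#)) ⟩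
    inv (s - 1#) - inv s                ∎
    where
    τs≈s : τ s ≈ s
    τs≈s = τ-fixed s≉0 s≉1

  ∑-inv·τ[τs+z] : ∀ s → ∑ (λ z → inv z * τ (τ s + z)) ≈ inv (s - 1#) - inv s - 1#
  ∑-inv·τ[τs+z] s = begin
    K                                                     ≈⟨ solve 2 (λ K b → K := (K :+ b) :- b) refl K b ⟩
    (K + b) - b                                           ≈⟨ +-congʳ (∑-inv·τ[y+z] (τ s)) ⟩
    (inv (0# - τ s) - 1#) - b                             ≈⟨ solve 2 (λ a b → (a :- con 1) :- b := (a :- b) :- con 1) refl (inv (0# - τ s)) b ⟩
    (inv (0# - τ s) - b) - 1#                             ≈⟨ +-congʳ (inv-τ-difference s) ⟩
    inv (s - 1#) - inv s - 1#                             ∎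
    where
    K = ∑ (λ z → inv z * τ (τ s + z))
    b = inv (1# - τ s)

  -- The function of the theorem: bijectivity in each variable and the moment (1,1,1)

  F₃ : Carrier → Carrier → Carrier → Carrier
  F₃ x y z = τ (τ (inv x ^ 3 + inv y) + inv z)

  ∑-F₃-z : ∀ x y → ∑ (λ z → F₃ x y z) ≈ 0#
  ∑-F₃-z x y = trans (∑-cong λ z → τ-cong (+-comm _ _))
    (∑-permutation (inversion ⨾ translation (τ (inv x ^ 3 + inv y)) ⨾ transposition))

  ∑-F₃-y : ∀ x z → ∑ (λ y → F₃ x y z) ≈ 0#
  ∑-F₃-y x z = trans (∑-cong λ y → τ-cong (+-congʳ (τ-cong (+-comm _ _))))
    (∑-permutation (inversion ⨾ translation (inv x ^ 3) ⨾ transposition ⨾ translation (inv z) ⨾ transposition))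

  -- Here the variable enters through `inv x ^ 3`, which is bijective because cubing is the
  -- Frobenius map.
  ∑-F₃-x : ∀ y z → ∑ (λ x → F₃ x y z) ≈ 0#
  ∑-F₃-x y z = ∑-permutation
    (inversion ⨾ cubing ⨾ translation (inv y) ⨾ transposition ⨾ translation (inv z) ⨾ transposition)

  ∑-F₃·xyz : ∑ (λ x → ∑ λ y → ∑ λ z → F₃ x y z * (x * (y * z))) ≈ 1#
  ∑-F₃·xyz = begin
    ∑ (λ x → ∑ λ y → ∑ λ z → F₃ x y z * (x * (y * z)))
      ≈⟨ ∑-cong (λ x → ∑-cong λ y → over-z x y) ⟩
    ∑ (λ x → ∑ λ y → x * (y * (inv (inv x ^ 3 + inv y - 1#) - inv (inv x ^ 3 + inv y) - 1#)))
      ≈⟨ ∑-cong over-y ⟩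
    ∑ (λ x → x * (inv (inv x ^ 3) ^ 2 - inv (inv x ^ 3 - 1#) ^ 2))
      ≈⟨ ∑-substitute-inv (λ eq → +-cong (^-congˡ 2 (inv-cong (^-congˡ 3 eq))) (-‿cong (^-congˡ 2 (inv-cong (+-congʳ (^-congˡ 3 eq)))))) ⟩
    ∑ (λ x → inv x * (inv (x ^ 3) ^ 2 - inv (x ^ 3 - 1#) ^ 2))
      ≈⟨ ∑-cong over-x ⟩
    ∑ (λ x → inv x ^ 7 - inv x * inv (x - 1#) ^ 6)
      ≈⟨ ∑-+≈ (trans (∑-permute inversion (^-congˡ 7)) (powerSum≈0 7)) (∑-neg ∑-inv·inv[x-1]⁶) ⟩
    0# - - 1#
      ≈⟨ solve 0 (con 0 :- (:- con 1) := con 1) refl ⟩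
    1# ∎
    where
    over-z : ∀ x y → ∑ (λ z → F₃ x y z * (x * (y * z))) ≈
                     x * (y * (inv (inv x ^ 3 + inv y - 1#) - inv (inv x ^ 3 + inv y) - 1#))
    over-z x y = begin
      ∑ (λ z → F₃ x y z * (x * (y * z)))         ≈⟨ ∑-cong (λ z → solve 4 (λ f x y z → f :* (x :* (y :* z)) := (x :* y) :* (z :* f)) refl (F₃ x y z) x y z) ⟩
      ∑ (λ z → (x * y) * (z * τ (τ s + inv z)))  ≈⟨ ∑-*≈ (x * y) (trans (∑-substitute-inv (τ-cong ∘ +-congˡ)) (∑-inv·τ[τs+z] s)) ⟩
      (x * y) * (inv (s - 1#) - inv s - 1#)      ≈⟨ *-assoc x y _ ⟩
      x * (y * (inv (s - 1#) - inv s - 1#))      ∎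
      where s = inv x ^ 3 + inv y

    over-y : ∀ x → ∑ (λ y → x * (y * (inv (inv x ^ 3 + inv y - 1#) - inv (inv x ^ 3 + inv y) - 1#))) ≈
                   x * (inv (inv x ^ 3) ^ 2 - inv (inv x ^ 3 - 1#) ^ 2)
    over-y x = ∑-*≈ x (begin
      ∑ (λ y → y * (inv (u + inv y - 1#) - inv (u + inv y) - 1#))
        ≈⟨ ∑-substitute-inv (λ eq → +-congʳ (+-cong (inv-cong (+-congʳ (+-congˡ eq))) (-‿cong (inv-cong (+-congˡ eq))))) ⟩
      ∑ (λ y → inv y * (inv (u + y - 1#) - inv (u + y) - 1#))
        ≈⟨ ∑-cong (λ y → trans
             (*-congˡ (+-congʳ (+-congʳ (inv-cong (solve 2 (λ u y → u :+ y :- con 1 := (u :- con 1) :+ y) refl u y)))))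
             (solve 3 (λ i a b → i :* (a :- b :- con 1) := (i :* a :- i :* b) :- i) refl (inv y) (inv (u - 1# + y)) (inv (u + y)))) ⟩
      ∑ (λ y → (inv y * inv (u - 1# + y) - inv y * inv (u + y)) - inv y)
        -- The constant -1 left by the sum over `z` contributes only minus the sum of all `inv y`,
        -- which is 0.
        ≈⟨ ∑-+≈ (∑-+≈ (∑-inv·inv[u+x] (u - 1#)) (∑-neg (∑-inv·inv[u+x] u))) (∑-neg ∑-inv) ⟩
      (- (inv (u - 1#) ^ 2) - - (inv u ^ 2)) - 0#
        ≈⟨ solve 2 (λ a b → ((:- (a :^ 2)) :- (:- (b :^ 2))) :- con 0 := b :^ 2 :- a :^ 2) refl (inv (u - 1#)) (inv u) ⟩
      inv u ^ 2 - inv (u - 1#) ^ 2 ∎)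
      where u = inv x ^ 3

    inv-^3 : ∀ x → inv (x ^ 3) ≈ inv x ^ 3
    inv-^3 x = begin
      inv (x * (x * (x * 1#)))            ≈⟨ trans (inv-* x _) (*-congˡ (trans (inv-* x _) (*-congˡ (inv-* x 1#)))) ⟩
      inv x * (inv x * (inv x * inv 1#))  ≈⟨ *-congˡ (*-congˡ (*-congˡ (inv-1 refl))) ⟩
      inv x ^ 3                           ∎

    over-x : ∀ x → inv x * (inv (x ^ 3) ^ 2 - inv (x ^ 3 - 1#) ^ 2) ≈ inv x ^ 7 - inv x * inv (x - 1#) ^ 6
    over-x x = begin
      inv x * (inv (x ^ 3) ^ 2 - inv (x ^ 3 - 1#) ^ 2)
        -- Frobenius gives `x^3 - 1 = (x - 1)^3`, so the squared inverse becomes a sixth power.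
        ≈⟨ *-congˡ (+-cong (^-congˡ 2 (inv-^3 x)) (-‿cong (^-congˡ 2 (trans
             (inv-cong (solve 1 (λ x → x :^ 3 :- con 1 := (x :- con 1) :^ 3) refl x)) (inv-^3 (x - 1#)))))) ⟩
      inv x * ((inv x ^ 3) ^ 2 - (inv (x - 1#) ^ 3) ^ 2)
        ≈⟨ solve 2 (λ a b → a :* ((a :^ 3) :^ 2 :- (b :^ 3) :^ 2) := a :^ 7 :- a :* b :^ 6) refl (inv x) (inv (x - 1#)) ⟩
      inv x ^ 7 - inv x * inv (x - 1#) ^ 6 ∎

  -- The degree of the reduced form

  open Polynomials rawRing using (Poly; coeff; IsReducedRepresentative; HasReducedDegree)

  module _ (f : Poly 3) (eval-f : ∀ x y z → eval (x ∷ y ∷ z ∷ []) f ≈ τ (τ (x ^ (5 ℕ.+ k) + inv y) + inv z)) where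

    eval-f≈F₃ : ∀ x y z → eval (x ∷ y ∷ z ∷ []) f ≈ F₃ x y z
    eval-f≈F₃ x y z = trans (eval-f x y z) (τ-cong (+-congʳ (τ-cong (+-congʳ (x^[q-4]≈inv³ x)))))

    coefficient-F₃ : ∀ {g} → IsReducedRepresentative (9 ℕ.+ k) f g →
      ∀ {a₁ a₂ a₃ b₁ b₂ b₃} → a₁ ℕ.+ b₁ ≡ 8 ℕ.+ k → a₂ ℕ.+ b₂ ≡ 8 ℕ.+ k → a₃ ℕ.+ b₃ ≡ 8 ℕ.+ k → 0 < a₁ → 0 < a₂ → 0 < a₃ →
      coeff g (a₁ ∷ a₂ ∷ a₃ ∷ []) * κ ≈ moment F₃ b₁ b₂ b₃
    coefficient-F₃ {g} representative {b₁ = b₁} {b₂} {b₃} eq₁ eq₂ eq₃ 0<a₁ 0<a₂ 0<a₃ = trans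
      (coefficient-moment {f} {g} representative eq₁ eq₂ eq₃ 0<a₁ 0<a₂ 0<a₃)
      (moment-cong eval-f≈F₃ b₁ b₂ b₃)

    top-coefficient : ∀ {g} → IsReducedRepresentative (9 ℕ.+ k) f g → ¬ coeff g (replicate 3 (7 ℕ.+ k)) ≈ 0#
    top-coefficient {g} representative ≈0 = 1≉0 (begin
      1#                                                          ≈⟨ ∑-F₃·xyz ⟨
      ∑ (λ x → ∑ λ y → ∑ λ z → F₃ x y z * (x * (y * z)))          ≈⟨ ∑-cong (λ x → ∑-cong λ y → ∑-cong λ z → *-congˡ
                                                                       (*-cong (*-identityʳ x) (*-cong (*-identityʳ y) (*-identityʳ z)))) ⟨
      moment F₃ 1 1 1                                             ≈⟨ coefficient-F₃ {g} representative N+1 N+1 N+1 (s≤s z≤n) (s≤s z≤n) (s≤s z≤n) ⟨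
      coeff g (replicate 3 (7 ℕ.+ k)) * κ                         ≈⟨ trans (*-congʳ ≈0) (zeroˡ κ) ⟩
      0#                                                          ∎)
      where
      N+1 : 7 ℕ.+ k ℕ.+ 1 ≡ 8 ℕ.+ k
      N+1 = ℕ.+-comm (7 ℕ.+ k) 1

    -- An exponent `q - 1` has complementary weight 0, so the coefficient is up to `κ` a moment that
    -- vanishes by bijectivity. Positivity of all three exponents is what identifies coefficient and
    -- moment.
    partial-degrees : ∀ {g} → IsReducedRepresentative (9 ℕ.+ k) f g →
      ∀ {e₁ e₂ e₃} → e₁ ≤ 8 ℕ.+ k → e₂ ≤ 8 ℕ.+ k → e₃ ≤ 8 ℕ.+ k → 0 < e₁ → 0 < e₂ → 0 < e₃ →
      ¬ coeff g (e₁ ∷ e₂ ∷ e₃ ∷ []) ≈ 0# → e₁ ≤ 7 ℕ.+ k × e₂ ≤ 7 ℕ.+ k × e₃ ≤ 7 ℕ.+ k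
    partial-degrees {g} representative {e₁} {e₂} {e₃} e₁≤ e₂≤ e₃≤ 0<e₁ 0<e₂ 0<e₃ ≉0 =
      below e₁≤ (λ { ≡.refl → nonzero (coefficient top (complement e₂≤) (complement e₃≤)) (moment-x-vanishes ∑-F₃-x (N ∸ e₂) (N ∸ e₃)) }) ,
      below e₂≤ (λ { ≡.refl → nonzero (coefficient (complement e₁≤) top (complement e₃≤)) (moment-y-vanishes ∑-F₃-y (N ∸ e₁) (N ∸ e₃)) }) ,
      below e₃≤ (λ { ≡.refl → nonzero (coefficient (complement e₁≤) (complement e₂≤) top) (moment-z-vanishes ∑-F₃-z (N ∸ e₁) (N ∸ e₂)) })
      where
      N = 8 ℕ.+ k

      below : ∀ {e} → e ≤ 8 ℕ.+ k → e ≢ 8 ℕ.+ k → e ≤ 7 ℕ.+ k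
      below e≤ e≢ = ℕ.≤-pred (ℕ.≤∧≢⇒< e≤ e≢)

      top : 8 ℕ.+ k ℕ.+ 0 ≡ 8 ℕ.+ k
      top = ℕ.+-identityʳ (8 ℕ.+ k)

      complement : ∀ {e} → e ≤ 8 ℕ.+ k → e ℕ.+ (8 ℕ.+ k ∸ e) ≡ 8 ℕ.+ k
      complement = ℕ.m+[n∸m]≡n

      coefficient : ∀ {b₁ b₂ b₃} → e₁ ℕ.+ b₁ ≡ 8 ℕ.+ k → e₂ ℕ.+ b₂ ≡ 8 ℕ.+ k → e₃ ℕ.+ b₃ ≡ 8 ℕ.+ k →
        coeff g (e₁ ∷ e₂ ∷ e₃ ∷ []) * κ ≈ moment F₃ b₁ b₂ b₃
      coefficient eq₁ eq₂ eq₃ = coefficient-F₃ {g} representative eq₁ eq₂ eq₃ 0<e₁ 0<e₂ 0<e₃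

      nonzero : ∀ {m} → coeff g (e₁ ∷ e₂ ∷ e₃ ∷ []) * κ ≈ m → ¬ m ≈ 0#
      nonzero eq m≈0 = ≉0 (no-zero-divisors κ≉0 (trans (*-comm κ _) (trans eq m≈0)))

    two-exponents : ∀ {x y} → x ≤ 8 ℕ.+ k → y ≤ 8 ℕ.+ k → x ℕ.+ (y ℕ.+ 0) ≤ 3 ℕ.* (7 ℕ.+ k)
    two-exponents {x} {y} x≤ y≤ = ℕ.≤-trans (ℕ.+-mono-≤ x≤ (ℕ.+-monoˡ-≤ 0 y≤))
      -- The slack is `3 (q - 2) - 2 (q - 1) = q - 4 = 5 + k`.
      (≡.subst (8 ℕ.+ k ℕ.+ (8 ℕ.+ k ℕ.+ 0) ≤_) arithmetic (ℕ.m≤m+n _ (5 ℕ.+ k)))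
      where
      open ℕ-Solver using () renaming (solve to solve-ℕ; _:+_ to _⊕_; _:*_ to _⊗_; con to con-ℕ; _:=_ to _≔_)
      arithmetic : 8 ℕ.+ k ℕ.+ (8 ℕ.+ k ℕ.+ 0) ℕ.+ (5 ℕ.+ k) ≡ 3 ℕ.* (7 ℕ.+ k)
      arithmetic = solve-ℕ 1 (λ k → con-ℕ 8 ⊕ k ⊕ (con-ℕ 8 ⊕ k ⊕ con-ℕ 0) ⊕ (con-ℕ 5 ⊕ k) ≔ con-ℕ 3 ⊗ (con-ℕ 7 ⊕ k)) ≡.refl k

    degree-bound : ∀ {g} → IsReducedRepresentative (9 ℕ.+ k) f g → ∀ e → ¬ coeff g e ≈ 0# → Vec.sum e ≤ 3 ℕ.* (7 ℕ.+ k)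
    degree-bound {g} representative e ≉0 = bound e ≉0 (proj₁ representative e ≉0)
      where
      bound : ∀ e → ¬ coeff g e ≈ 0# → All (_< 9 ℕ.+ k) e → Vec.sum e ≤ 3 ℕ.* (7 ℕ.+ k)
      bound (zero   ∷ e₂     ∷ e₃     ∷ []) _ (_ ∷ s≤s e₂≤ ∷ s≤s e₃≤ ∷ []) = two-exponents e₂≤ e₃≤
      bound (suc e₁ ∷ zero   ∷ e₃     ∷ []) _ (s≤s e₁≤ ∷ _ ∷ s≤s e₃≤ ∷ []) = two-exponents e₁≤ e₃≤
      bound (suc e₁ ∷ suc e₂ ∷ zero   ∷ []) _ (s≤s e₁≤ ∷ s≤s e₂≤ ∷ _ ∷ []) = two-exponents e₁≤ e₂≤
      bound (suc e₁ ∷ suc e₂ ∷ suc e₃ ∷ []) ≉0 (s≤s e₁≤ ∷ s≤s e₂≤ ∷ s≤s e₃≤ ∷ [])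
        with partial-degrees {g} representative e₁≤ e₂≤ e₃≤ (s≤s z≤n) (s≤s z≤n) (s≤s z≤n) ≉0
      ... | e₁≤N , e₂≤N , e₃≤N = ℕ.+-mono-≤ e₁≤N (ℕ.+-mono-≤ e₂≤N (ℕ.+-monoˡ-≤ 0 e₃≤N))

    reduced-degree : HasReducedDegree (9 ℕ.+ k) f (3 ℕ.* (7 ℕ.+ k))
    reduced-degree = reduced-representative (9 ℕ.+ k) (s≤s (s≤s z≤n)) f , λ g representative →
      (replicate 3 (7 ℕ.+ k) , top-coefficient {g} representative , ≡.refl) , degree-bound {g} representative

  -- Stated for a variable q, so that f̄₃ q is never unfolded.
  reduced-degree-of : ∀ q → q ≡ 9 ℕ.+ k → (f : Poly 3) →
    (∀ x y z → eval (x ∷ y ∷ z ∷ []) f ≈ tAt q (tAt q (x ^ (q ∸ 4) + y ^ (q ∸ 2)) + z ^ (q ∸ 2))) →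
    HasReducedDegree q f (3 ℕ.* (q ∸ 2))
  reduced-degree-of _ ≡.refl = reduced-degree

-- From Heyting fields to the theorem

-- A Heyting field inverts what is apart from 0, while `x` is only known to be unequal to 0.
-- Searching the finitely many elements decides whether an inverse exists; if none does, `x` is not
-- apart from 0, and tightness gives `x ≈ 0`.
invertible-if-nonzero : ∀ {c ℓ₁ ℓ₂ q} (F : HeytingField c ℓ₁ ℓ₂) → HasCardinality F q → NonzeroInvertible (fieldRing F)
invertible-if-nonzero F enumeration x x≉0 with Fin.any? (λ i → (x * from i) ≟ 1#)
  where
  open HeytingField F using (_*_; 1#)
  open Inverse enumeration using (from)
  _≟_ = via-injection (Inverse⇒Injection enumeration) Fin._≟_
... | yes (i , xy≈1) = Inverse.from enumeration i , xy≈1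
... | no  none       = contradiction (proj₁ (tight x 0#) not-apart) x≉0
  where
  open HeytingField F
  open Inverse enumeration using (to; strictlyInverseʳ)
  open import Algebra.Apartness.Properties.HeytingCommutativeRing heytingCommutativeRing using (x-0≈x)
  not-apart : ¬ x # 0#
  not-apart x#0 with #⇒invertible x#0
  ... | y , _ , [x-0]y≈1 = none (to y , trans (*-congˡ (strictlyInverseʳ y)) (trans (*-congʳ (sym (x-0≈x x))) [x-0]y≈1))

open import Data.Nat.Base using (_*_; _^_)

mainTheorem16 : ∀ {c ℓ₁ ℓ₂} (q r : ℕ) → q ≡ 3 ^ r → 3 < q →
    (F : HeytingField c ℓ₁ ℓ₂) → HasCardinality F q →
    let open Polynomials (CommutativeRing.rawRing (fieldRing F)) in
    HasReducedDegree {3} q (f̄₃ q (X 0F) (X 1F) (X 2F)) (3 * (q ∸ 2))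
-- `3 < q` excludes `q = 1` and `q = 3`; all further powers of 3 are at least 9.
mainTheorem16 q zero          ≡.refl (s≤s ())
mainTheorem16 q (suc zero)    ≡.refl (s≤s (s≤s (s≤s ())))
mainTheorem16 q (suc (suc r)) q≡ 3<q F enumeration =
  reduced-degree-of q (≡.sym 9+k≡q) (f̄₃ q (X 0F) (X 1F) (X 2F)) (λ x y z → eval-f̄₃ (x ∷ y ∷ z ∷ []) q 0F 1F 2F)
  where
  9≤q : 9 ℕ.≤ q
  9≤q = ≡.subst (9 ℕ.≤_) (≡.sym q≡) (ℕ.*-monoʳ-≤ 3 (ℕ.*-monoʳ-≤ 3 (ℕ.m^n>0 3 r)))

  k : ℕ
  k = q ∸ 9

  9+k≡q : 9 ℕ.+ k ≡ q
  9+k≡q = ℕ.m+[n∸m]≡n 9≤q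

  enumeration′ : HasCardinality F (9 ℕ.+ k)
  enumeration′ = ≡.subst (HasCardinality F) (≡.sym 9+k≡q) enumeration

  open Polynomials (CommutativeRing.rawRing (fieldRing F)) using (X; f̄₃)
  open FormalSums (fieldRing F) using (eval-f̄₃)
  open CharacteristicThree (fieldRing F) k enumeration′ (invertible-if-nonzero F enumeration′) (suc r) (≡.trans 9+k≡q q≡)
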